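{- For all $L\in\mathbf N$, $$G\left(L,L,\tfrac{11}{4},\tfrac{5}{2},4,q\right)\geq 0,$$ and for all integers $L\ge 1$, $$G\left(L-1,L+1,4,\tfrac{5}{4},4,q\right)\geq 0,\qquad G\left(L-1,L+1,\tfrac{15}{4},\tfrac{3}{2},4,q\right)\geq 0.$$
   Context: $\mathbf N$ denotes the set of nonnegative integers. For $m\in\mathbf N$, $(q)_m=\prod_{j=1}^m(1-q^j)$, with $(q)_0=1$. The $q$-binomial coefficient is $\begin{bmatrix} m+n\\ m\end{bmatrix}_q=\frac{(q)_{m+n}}{(q)_m(q)_n}$ if $m,n\in\mathbf N$, and it is $0$ otherwise (so $\begin{bmatrix} A\\ B\end{bmatrix}_q=0$ unless $0\le B\le A$). Define $$G(N,M,\alpha,\beta,K,q)=\sum_{j=-\infty}^\infty(-1)^j q^{Kj\frac{(\alpha+\beta)j+(\alpha-\beta)}{2}}\begin{bmatrix} N+M\\ N-Kj\end{bmatrix}_q .$$ The notation $P(q)\ge 0$ means that $P(q)$ is a polynomial in $q$ with nonnegative coefficients. -}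

module Defs where

open import Data.Bool.Base using (if_then_else_)
open import Data.Fin.Base using (toℕ)
open import Data.Integer.Base as ℤ
  using (ℤ; +_; -[1+_]; 0ℤ; 1ℤ; -1ℤ; ∣_∣)
import Data.Integer.Properties as ℤₚ
import Data.Integer.Tactic.RingSolver as ℤ-Solver
open import Data.Nat.Base as ℕ using (ℕ; zero; suc; NonZero)
import Data.Nat.Properties as ℕₚ
open import Data.Product.Base using (_×_; _,_; ∃-syntax)
open import Data.Rational.Base as ℚ using (ℚ; mkℚ; ½)
open import Relation.Binary.PropositionalEquality
  using (_≡_; _≗_; refl; sym; trans; cong; cong₂; subst)

open import Algebra.Properties.CommutativeMonoid.Sum ℤₚ.+-0-commutativeMonoid
  using (sum-syntax)

------------------------------------------------------------------------
-- Formal power series in q over ℤ, as coefficient sequences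

Series : Set
Series = ℕ → ℤ

0ₛ : Series
0ₛ _ = 0ℤ

q^_ : ℕ → Series
(q^ j) n = if n ℕ.≡ᵇ j then 1ℤ else 0ℤ

infixl 6 _-ₛ_
infixl 7 _*ₛ_ _÷ₛ_

_-ₛ_ : Series → Series → Series
(a -ₛ b) n = a n ℤ.- b n

_*ₛ_ : Series → Series → Series
(a *ₛ b) n = ∑[ i < suc n ] (a (toℕ i) ℤ.* b (n ℕ.∸ toℕ i))

-- Long division in ascending powers of q.  It is the quotient in ℤ[[q]]
-- when the divisor has constant term 1 (see ÷ₛ-*ₛ below), which is the
-- only case in which it is used.
_÷ₛ_ : Series → Series → Series
(a ÷ₛ b) zero    = a 0
(a ÷ₛ b) (suc n) = ((λ k → a (suc k) ℤ.- a 0 ℤ.* b (suc k)) ÷ₛ b) n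

÷ₛ-*ₛ : ∀ a b → b 0 ≡ 1ℤ → (a ÷ₛ b) *ₛ b ≗ a
÷ₛ-*ₛ a b b₀≡1 zero    = trans (ℤₚ.+-identityʳ _)
  (trans (cong (a 0 ℤ.*_) b₀≡1) (ℤₚ.*-identityʳ (a 0)))
÷ₛ-*ₛ a b b₀≡1 (suc n) = trans
  (cong (λ z → a 0 ℤ.* b (suc n) ℤ.+ z)
    (÷ₛ-*ₛ (λ k → a (suc k) ℤ.- a 0 ℤ.* b (suc k)) b b₀≡1 n))
  (cancel (a 0 ℤ.* b (suc n)) (a (suc n)))
  where
  cancel : ∀ x y → x ℤ.+ (y ℤ.- x) ≡ y
  cancel = ℤ-Solver.solve-∀

------------------------------------------------------------------------
-- q-binomial coefficients

⟨q⟩_ : ℕ → Series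
⟨q⟩ zero  = q^ 0
⟨q⟩ suc m = ⟨q⟩ m *ₛ (q^ 0 -ₛ q^ suc m)

⟨q⟩-const : ∀ m → (⟨q⟩ m) 0 ≡ 1ℤ
⟨q⟩-const zero    = refl
⟨q⟩-const (suc m) =
  cong (λ z → z ℤ.* 1ℤ ℤ.+ 0ℤ) (⟨q⟩-const m)

-- gaussian m n is the q-binomial coefficient with top m + n and bottom m.
gaussian : ℤ → ℤ → Series
gaussian (+ m) (+ n) = ⟨q⟩ (m ℕ.+ n) ÷ₛ (⟨q⟩ m *ₛ ⟨q⟩ n)
gaussian _     _     = 0ₛ

qbinom : ℤ → ℤ → Series
qbinom A B = gaussian B (A ℤ.- B)

gaussian-quotient : ∀ m n →
  gaussian (+ m) (+ n) *ₛ (⟨q⟩ m *ₛ ⟨q⟩ n) ≗ ⟨q⟩ (m ℕ.+ n)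
gaussian-quotient m n = ÷ₛ-*ₛ _ _
  (cong₂ (λ x y → x ℤ.* y ℤ.+ 0ℤ) (⟨q⟩-const m) (⟨q⟩-const n))

------------------------------------------------------------------------
-- Formal sums of rational powers of q

-- P r is the coefficient of q^r.  Rational exponents are needed because
-- α and β are arbitrary rationals in G.
FormalSum : Set
FormalSum = ℚ → ℤ

-- Relies on ℚ being in lowest terms: r is a natural number iff its
-- numerator is nonnegative and its denominator (minus one) is zero.
embed : Series → FormalSum
embed a (mkℚ (+ n) zero _) = a n
embed a _                  = 0ℤ

q^_·_ : ℚ → FormalSum → FormalSum
(q^ e · P) r = P (r ℚ.- e)

infix 4 _≥0

_≥0 : FormalSum → Set
P ≥0 = ∃[ c ] (∃[ d ] (∀ n → d ℕ.< n → c n ≡ 0ℤ))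
            × (∀ n → 0ℤ ℤ.≤ c n)
            × P ≗ embed c

------------------------------------------------------------------------
-- The sum G(N,M,α,β,K,q)

fromℤ : ℤ → ℚ
fromℤ i = i ℚ./ 1

exponent : ℚ → ℚ → ℕ → ℤ → ℚ
exponent α β K j =
  fromℤ (+ K ℤ.* j) ℚ.* (((α ℚ.+ β) ℚ.* fromℤ j ℚ.+ (α ℚ.- β)) ℚ.* ½)

summand : ℤ → ℤ → ℚ → ℚ → ℕ → ℤ → FormalSum
summand N M α β K j r =
  (-1ℤ ℤ.^ ∣ j ∣) ℤ.*
  (q^ exponent α β K j · embed (qbinom (N ℤ.+ M) (N ℤ.- + K ℤ.* j))) r

-- The sum over all j ∈ ℤ is taken over |j| ≤ |N| + |M|; the remaining
-- summands are zero by summand-outside.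
G : (N M : ℤ) (α β : ℚ) (K : ℕ) .{{_ : NonZero K}} → FormalSum
G N M α β K r =
  ∑[ i < suc (W ℕ.+ W) ] summand N M α β K (+ toℕ i ℤ.- + W) r
  where
  W : ℕ
  W = ∣ N ∣ ℕ.+ ∣ M ∣

private
  i≤∣i∣ : ∀ i → i ℤ.≤ + ∣ i ∣
  i≤∣i∣ (+ n)    = ℤₚ.≤-refl
  i≤∣i∣ -[1+ n ] = ℤ.-≤+

  gaussian-neg₁ : ∀ {x} y → x ℤ.< 0ℤ → gaussian x y ≗ 0ₛ
  gaussian-neg₁ {+ _}      y (ℤ.+<+ ())
  gaussian-neg₁ { -[1+ _ ]} y _ k = refl

  gaussian-neg₂ : ∀ x {y} → y ℤ.< 0ℤ → gaussian x y ≗ 0ₛ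
  gaussian-neg₂ x          {+ _}       (ℤ.+<+ ())
  gaussian-neg₂ (+ _)      { -[1+ _ ]} _ k = refl
  gaussian-neg₂ -[1+ _ ]   { -[1+ _ ]} _ k = refl

  small : ∀ X K n .{{_ : NonZero K}} → ∣ X ∣ ℕ.< n →
          X ℤ.- + K ℤ.* + n ℤ.< 0ℤ
  small X K n ∣X∣<n = subst (X ℤ.- + K ℤ.* + n ℤ.<_)
    (ℤₚ.+-inverseʳ (+ K ℤ.* + n))
    (ℤₚ.+-monoˡ-< (ℤ.- (+ K ℤ.* + n)) (ℤₚ.≤-<-trans (i≤∣i∣ X)
      (subst (+ ∣ X ∣ ℤ.<_) (ℤₚ.pos-* K n)
        (ℤ.+<+ (ℕₚ.<-≤-trans ∣X∣<n (ℕₚ.m≤n*m n K))))))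

  complement : ∀ N M k n →
    N ℤ.+ M ℤ.- (N ℤ.- k ℤ.* (ℤ.- n)) ≡ M ℤ.- k ℤ.* n
  complement = ℤ-Solver.solve-∀

  embed-0 : ∀ {a} → a ≗ 0ₛ → ∀ r → embed a r ≡ 0ℤ
  embed-0 a≗0 (mkℚ (+ n) zero _)    = a≗0 n
  embed-0 a≗0 (mkℚ (+ n) (suc _) _) = refl
  embed-0 a≗0 (mkℚ -[1+ n ] _ _)    = refl

qbinom-outside : ∀ N M K j .{{_ : NonZero K}} →
  ∣ N ∣ ℕ.+ ∣ M ∣ ℕ.< ∣ j ∣ → qbinom (N ℤ.+ M) (N ℤ.- + K ℤ.* j) ≗ 0ₛ
qbinom-outside N M K (+ n) W<n =
  gaussian-neg₁ _ (small N K n (ℕₚ.≤-<-trans (ℕₚ.m≤m+n ∣ N ∣ ∣ M ∣) W<n))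
qbinom-outside N M K -[1+ n ] W<n =
  gaussian-neg₂ (N ℤ.- + K ℤ.* -[1+ n ])
    (subst (ℤ._< 0ℤ) (sym (complement N M (+ K) (+ suc n)))
      (small M K (suc n) (ℕₚ.≤-<-trans (ℕₚ.m≤n+m ∣ M ∣ ∣ N ∣) W<n)))

summand-outside : ∀ N M α β K j .{{_ : NonZero K}} →
  ∣ N ∣ ℕ.+ ∣ M ∣ ℕ.< ∣ j ∣ → ∀ r → summand N M α β K j r ≡ 0ℤ
summand-outside N M α β K j W<j r = trans
  (cong ((-1ℤ ℤ.^ ∣ j ∣) ℤ.*_)
    (embed-0 (qbinom-outside N M K j W<j) (r ℚ.- exponent α β K j)))
  (ℤₚ.*-zeroʳ (-1ℤ ℤ.^ ∣ j ∣))

{-# OPTIONS --safe #-}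

-- Applying the q-Vandermonde convolution twice gives, for m = 2μ + e,
--   q^(2μ(μ+e)) [2L , L+m] = Σ_{t,c} κ(e,L,t,c) [2t+e , t+e+μ]
-- with a kernel κ that has nonnegative coefficients and does not depend on μ.
-- Taking μ = 2j (e = 0) or μ = 2j, 2j+1 (e = 1) reduces positivity of the three
-- sums, quadratic in q^(21j²/2) and with K = 4, to that of Rogers-Ramanujan sums,
-- quadratic in q^(5j²/2) and with K = 2.  The Pascal recurrences turn the odd
-- cases of those into the case e = 0 or into sums to which the same transformation
-- applies again; what is then left is
--   Σ_j (-1)^j q^(j(j+1)/2) [2t , t-j] = δ_{t,0},
-- which telescopes.  The Rogers-Ramanujan sums come out as Σ_c q^(c²) [s , c]
-- and Σ_c q^(c²+c) [s , c].
module Submission where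

open import Algebra.Bundles using (CommutativeRing)
import Algebra.Construct.Pointwise as Pointwise
import Algebra.Properties.Ring as RingProperties
open import Data.Fin.Base using (toℕ)
import Data.Fin.Properties as Finₚ
open import Data.Integer.Base as ℤ using (ℤ; -[1+_]; 0ℤ; 1ℤ; -1ℤ; ∣_∣; _⊖_)
import Data.Integer.Properties as ℤₚ
import Data.Integer.Tactic.RingSolver as ℤ-Solver
open import Data.Nat.Base using (ℕ; zero; suc; z≤n; s≤s; z<s; s<s)
import Data.Nat.Coprimality as Coprimality
import Data.Nat.Properties as ℕₚ
open import Data.Nat.Tactic.RingSolver using (solve-∀)
open import Data.Rational.Base as ℚ using (ℚ; mkℚ; ½)
import Data.Rational.Properties as ℚₚ
import Data.Rational.Solver as ℚ-Solver
open import Data.Sum.Base using (inj₁; inj₂)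
open import Function.Base using (_∘_)
open import Level using (0ℓ)
import Relation.Binary.PropositionalEquality as ≡
open ≡ using (_≡_)
open import Relation.Nullary.Negation using (contradiction)

-- The constants record how much of the quadratic form one transformation uses up. For an offset 4j
-- + e = 2μ + e the prefactor exponent 2μ(μ + e) is 8j² + 4ej, and 21/2 - 8 = 5/2; for K = 2 and e =
-- 0 it is 2j², and 5/2 - 2 = 1/2, where the sum can be evaluated in closed form. Parity is the
-- obstacle. The transformation accepts an even top 2L, but for e = 1 it returns the odd top 2t + 1,
-- so it cannot simply be iterated. Lowering the top by Pascal is useful only because the unwanted
-- terms cancel between j = k and j = -1 - k, or carry a power of q that does not depend on j.
-- Moreover μ is a natural number, the absolute offset, so j ≥ 0 and j < 0 form two families with
-- different μ. This is why every alternating sum is kept as a sum of such pairs. The identities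
-- hold in any commutative ring with powers of q; only positivity and the comparison with quotients
-- refer to integer power series.

module QBinomial {c ℓ} (R : CommutativeRing c ℓ) where

  open import Data.Nat.Base using (_+_; _*_; _∸_; _≤_; _<_)
  open CommutativeRing R
    renaming (_+_ to infixl 6 _⊕_; _*_ to infixl 7 _·_)
    hiding (_-_)
  open import Algebra.Properties.CommutativeMonoid.Sum +-commutativeMonoid
    using (sum; sum-cong-≋; sum-replicate-zero; ∑-distrib-+; ∑-comm)
  open import Algebra.Properties.Semiring.Sum semiring using (*-distribˡ-sum)
  open import Algebra.Solver.Ring.NaturalCoefficients.Default commutativeSemiring
    using (solve; _:*_; _:+_; _:=_; con)
  open import Relation.Binary.Reasoning.Setoid setoid

  -- Finite sums

  opaque

    ∑ : ℕ → (ℕ → Carrier) → Carrier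
    ∑ n f = sum {n} (λ i → f (toℕ i))

    ∑-cong< : ∀ n {f g} → (∀ i → i < n → f i ≈ g i) → ∑ n f ≈ ∑ n g
    ∑-cong< n f≈g = sum-cong-≋ (λ i → f≈g (toℕ i) (Finₚ.toℕ<n i))

    ∑-cong : ∀ n {f g} → (∀ i → f i ≈ g i) → ∑ n f ≈ ∑ n g
    ∑-cong n f≈g = ∑-cong< n (λ i _ → f≈g i)

    ∑-zero : ∀ n {f} → (∀ i → f i ≈ 0#) → ∑ n f ≈ 0#
    ∑-zero n f≈0 = trans (∑-cong n f≈0) (sum-replicate-zero n)

    ∑-distrib : ∀ n f g → ∑ n (λ i → f i ⊕ g i) ≈ ∑ n f ⊕ ∑ n g
    ∑-distrib n f g = ∑-distrib-+ {n} (f ∘ toℕ) (g ∘ toℕ)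

    ∑-scale : ∀ n x f → x · ∑ n f ≈ ∑ n (λ i → x · f i)
    ∑-scale n x f = *-distribˡ-sum {n} x (f ∘ toℕ)

    ∑-swap : ∀ m n (f : ℕ → ℕ → Carrier) →
             ∑ m (λ i → ∑ n (f i)) ≈ ∑ n (λ j → ∑ m (λ i → f i j))
    ∑-swap m n f = ∑-comm {m} {n} (λ i j → f (toℕ i) (toℕ j))

    ∑-empty : ∀ f → ∑ 0 f ≈ 0#
    ∑-empty f = refl

    ∑-cons : ∀ n f → ∑ (suc n) f ≈ f 0 ⊕ ∑ n (f ∘ suc)
    ∑-cons n f = refl

    ∑-snoc : ∀ n f → ∑ (suc n) f ≈ ∑ n f ⊕ f n
    ∑-snoc zero    f = +-comm _ _
    ∑-snoc (suc n) f = trans (+-congˡ (∑-snoc n (f ∘ suc))) (sym (+-assoc _ _ _))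

    ∑-extend : ∀ n k {f} → (∀ i → n ≤ i → f i ≈ 0#) → ∑ (n + k) f ≈ ∑ n f
    ∑-extend zero    k f≈0 = ∑-zero k (λ i → f≈0 i z≤n)
    ∑-extend (suc n) k f≈0 = +-congˡ (∑-extend n k (λ i n≤i → f≈0 (suc i) (s≤s n≤i)))

    ∑-shift : ∀ a n {f} → (∀ i → i < a → f i ≈ 0#) →
              ∑ (a + n) f ≈ ∑ n (λ i → f (a + i))
    ∑-shift zero    n f≈0 = refl
    ∑-shift (suc a) n f≈0 = trans (+-cong (f≈0 0 z<s)
      (∑-shift a n (λ i i<a → f≈0 (suc i) (s<s i<a)))) (+-identityˡ _)

  ∑-single : ∀ f → ∑ 1 f ≈ f 0
  ∑-single f = trans (∑-cons 0 f) (trans (+-congˡ (∑-empty (f ∘ suc))) (+-identityʳ _))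

  -- A sum supported on a ≤ i ≤ n may be taken over any longer range.
  ∑-window : ∀ a n {f} → (∀ i → i < a → f i ≈ 0#) → (∀ i → n ≤ i → f i ≈ 0#) →
             ∑ n f ≈ ∑ n (λ i → f (a + i))
  ∑-window a n {f} below above = begin
    ∑ n f                   ≈⟨ ∑-extend n a above ⟨
    ∑ (n + a) f             ≡⟨ ≡.cong (λ k → ∑ k f) (ℕₚ.+-comm n a) ⟩
    ∑ (a + n) f             ≈⟨ ∑-shift a n below ⟩
    ∑ n (λ i → f (a + i))   ∎

  -- Splitting at -1 rather than at 0 follows the constructors of ℤ: raising `W` by one adds just
  -- the most negative term `-[1+ W ]` at the front.
  ∑-bilateral : ∀ W n (f : ℤ → Carrier) →
    ∑ (W + n) (λ i → f (i ⊖ W)) ≈ ∑ n (λ k → f (ℤ.+ k)) ⊕ ∑ W (λ k → f -[1+ k ])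
  ∑-bilateral zero    n f = sym (trans (+-congˡ (∑-empty _)) (+-identityʳ _))
  ∑-bilateral (suc W) n f = begin
    ∑ (suc W + n) (λ i → f (i ⊖ suc W))
      ≈⟨ ∑-cons (W + n) (λ i → f (i ⊖ suc W)) ⟩
    f -[1+ W ] ⊕ ∑ (W + n) (λ i → f (suc i ⊖ suc W))
      ≈⟨ +-congˡ (∑-cong (W + n) (λ i → reflexive (≡.cong f (ℤₚ.[1+m]⊖[1+n]≡m⊖n i W)))) ⟩
    f -[1+ W ] ⊕ ∑ (W + n) (λ i → f (i ⊖ W))
      ≈⟨ +-congˡ (∑-bilateral W n f) ⟩
    f -[1+ W ] ⊕ (∑ n (λ k → f (ℤ.+ k)) ⊕ ∑ W (λ k → f -[1+ k ]))
      ≈⟨ solve 3 (λ x y z → x :+ (y :+ z) := y :+ (z :+ x)) refl _ _ _ ⟩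
    ∑ n (λ k → f (ℤ.+ k)) ⊕ (∑ W (λ k → f -[1+ k ]) ⊕ f -[1+ W ])
      ≈⟨ +-congˡ (∑-snoc W (λ k → f -[1+ k ])) ⟨
    ∑ n (λ k → f (ℤ.+ k)) ⊕ ∑ (suc W) (λ k → f -[1+ k ]) ∎

  -- q^_ is only required to be a homomorphism; were it defined by recursion,
  -- unification could not recover exponents.
  module Gaussian (q^_ : ℕ → Carrier) (q^0 : q^ 0 ≈ 1#)
    (q^-+ : ∀ a b → q^ (a + b) ≈ q^ a · q^ b) where

    -- Recursive q-binomial coefficients: Pascal, symmetry, Vandermonde

    bin : ℕ → ℕ → Carrier
    bin n       zero    = 1#
    bin zero    (suc k) = 0#
    bin (suc n) (suc k) = bin n k ⊕ q^ suc k · bin n (suc k)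

    bin-> : ∀ {n k} → n < k → bin n k ≈ 0#
    bin-> {zero}  {suc k} _         = refl
    bin-> {suc n} {suc k} (s<s n<k) = trans
      (+-cong (bin-> n<k) (trans (*-congˡ (bin-> (ℕₚ.m<n⇒m<1+n n<k))) (zeroʳ _)))
      (+-identityˡ 0#)

    q^-cong : ∀ {a b} → a ≡ b → q^ a ≈ q^ b
    q^-cong = reflexive ∘ ≡.cong q^_

    q^-merge : ∀ {a b c} x → a + b ≡ c → q^ a · (q^ b · x) ≈ q^ c · x
    q^-merge {a} {b} {c} x a+b≡c = begin
      q^ a · (q^ b · x)  ≈⟨ *-assoc _ _ _ ⟨
      q^ a · q^ b · x    ≈⟨ *-congʳ (q^-+ a b) ⟨
      q^ (a + b) · x      ≈⟨ *-congʳ (q^-cong a+b≡c) ⟩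
      q^ c · x            ∎

    q^-exchange : ∀ {a b a′ b′} x → a + b ≡ a′ + b′ →
                 q^ a · (q^ b · x) ≈ q^ a′ · (q^ b′ · x)
    q^-exchange x eq = trans (q^-merge x eq) (sym (q^-merge x ≡.refl))

    -- The companion of the defining recurrence, with the power of q on the other term. Where
    -- `n ∸ k` truncates, the coefficient next to it is zero.
    pascalʳ : ∀ n k → bin (suc n) (suc k) ≈ q^ (n ∸ k) · bin n k ⊕ bin n (suc k)
    pascalʳ zero    zero    = +-cong (sym (trans (*-identityʳ _) q^0)) (zeroʳ _)
    pascalʳ zero    (suc k) = +-cong (sym (zeroʳ _)) (zeroʳ _)
    pascalʳ (suc n) zero    = begin
      1# ⊕ q^ 1 · bin (suc n) 1                  ≈⟨ +-congˡ (*-congˡ (pascalʳ n 0)) ⟩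
      1# ⊕ q^ 1 · (q^ n · 1# ⊕ bin n 1)         ≈⟨ solve 4 (λ a x y z →
        con 1 :+ a :* (x :+ z) := a :* x :+ (con 1 :+ a :* z)) refl (q^ 1) _ 0# _ ⟩
      q^ 1 · (q^ n · 1#) ⊕ (1# ⊕ q^ 1 · bin n 1) ≈⟨ +-congʳ (q^-merge 1# ≡.refl) ⟩
      q^ suc n · 1# ⊕ (1# ⊕ q^ 1 · bin n 1)     ∎
    pascalʳ (suc n) (suc k) = begin
      bin (suc n) (suc k) ⊕ q^ suc (suc k) · bin (suc n) (suc (suc k))
        ≈⟨ +-cong (pascalʳ n k) (*-congˡ (pascalʳ n (suc k))) ⟩
      (q^ (n ∸ k) · b₀ ⊕ b₁) ⊕ q^ suc (suc k) · (q^ (n ∸ suc k) · b₁ ⊕ b₂)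
        ≈⟨ solve 6 (λ x b₀ b₁ y z b₂ →
          (x :* b₀ :+ b₁) :+ y :* (z :* b₁ :+ b₂)
          := x :* b₀ :+ y :* (z :* b₁) :+ (b₁ :+ y :* b₂))
          refl (q^ (n ∸ k)) b₀ b₁ (q^ suc (suc k)) (q^ (n ∸ suc k)) b₂ ⟩
      q^ (n ∸ k) · b₀ ⊕ q^ suc (suc k) · (q^ (n ∸ suc k) · b₁)
        ⊕ (b₁ ⊕ q^ suc (suc k) · b₂)
        ≈⟨ +-congʳ (+-congˡ exchange) ⟩
      q^ (n ∸ k) · b₀ ⊕ q^ (n ∸ k) · (q^ suc k · b₁) ⊕ (b₁ ⊕ q^ suc (suc k) · b₂)
        ≈⟨ +-congʳ (distribˡ _ _ _) ⟨
      q^ (n ∸ k) · (b₀ ⊕ q^ suc k · b₁) ⊕ (b₁ ⊕ q^ suc (suc k) · b₂) ∎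
      where
      b₀ = bin n k
      b₁ = bin n (suc k)
      b₂ = bin n (suc (suc k))
      exchange : q^ suc (suc k) · (q^ (n ∸ suc k) · b₁) ≈ q^ (n ∸ k) · (q^ suc k · b₁)
      exchange with ℕₚ.<-≤-connex k n
      ... | inj₁ k<n = q^-exchange b₁ (≡.trans
        (≡.cong suc (ℕₚ.m+[n∸m]≡n k<n))
        (≡.sym (≡.trans (ℕₚ.+-suc (n ∸ k) k) (≡.cong suc (ℕₚ.m∸n+n≡m (ℕₚ.<⇒≤ k<n))))))
      ... | inj₂ n≤k = trans (vanish _ _) (sym (vanish _ _))
        where
        vanish : ∀ x y → x · (y · b₁) ≈ 0#
        vanish x y = trans (*-congˡ (trans (*-congˡ (bin-> (s≤s n≤k))) (zeroʳ y))) (zeroʳ x)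

    -- Complementing the lower index exchanges the two Pascal rules, so the defining recurrence on
    -- one side becomes `pascalʳ` on the other.
    bin-sym : ∀ a b → bin (a + b) a ≈ bin (a + b) b
    bin-diag : ∀ n → 1# ≈ bin n n
    bin-diag zero    = refl
    bin-diag (suc n) = begin
      1#                                   ≈⟨ bin-diag n ⟩
      bin n n                              ≈⟨ +-identityʳ _ ⟨
      bin n n ⊕ 0#                         ≈⟨ +-congˡ (trans (*-congˡ (bin-> (ℕₚ.n<1+n n))) (zeroʳ _)) ⟨
      bin n n ⊕ q^ suc n · bin n (suc n)  ∎
    bin-sym zero    b       = bin-diag b
    bin-sym (suc a) zero    = trans
      (reflexive (≡.cong (λ n → bin n (suc a)) (ℕₚ.+-identityʳ (suc a))))
      (sym (bin-diag (suc a)))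
    bin-sym (suc a) (suc b) = begin
      bin n a ⊕ q^ suc a · bin n (suc a)      ≈⟨ +-cong (bin-sym a (suc b)) (*-cong (q^-cong (≡.sym expo)) swap) ⟩
      bin n (suc b) ⊕ q^ (n ∸ b) · bin n b    ≈⟨ +-comm _ _ ⟩
      q^ (n ∸ b) · bin n b ⊕ bin n (suc b)    ≈⟨ pascalʳ n b ⟨
      bin (suc n) (suc b)                      ∎
      where
      n = a + suc b
      n≡ : n ≡ suc a + b
      n≡ = ℕₚ.+-suc a b
      expo : n ∸ b ≡ suc a
      expo = ≡.trans (≡.cong (_∸ b) n≡) (ℕₚ.m+n∸n≡m (suc a) b)
      swap : bin n (suc a) ≈ bin n b
      swap = ≡.subst (λ n → bin n (suc a) ≈ bin n b) (≡.sym n≡) (bin-sym (suc a) b)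

    -- The q-Vandermonde convolution, with the lower index of the first factor
    -- complemented so that no subtraction occurs.
    vandermonde : ∀ x y m →
      ∑ (suc x) (λ i → q^ (i * (i + m)) · (bin x i · bin y (i + m)))
        ≈ bin (x + y) (x + m)
    vandermonde zero y m =
      trans (∑-single _) (trans (*-cong q^0 (*-identityˡ _)) (*-identityˡ _))
    vandermonde (suc x) y m = begin
      ∑ (suc (suc x)) F
        ≈⟨ ∑-cons (suc x) F ⟩
      F 0 ⊕ ∑ (suc x) (F ∘ suc)
        ≈⟨ +-cong F₀≈B₀ (trans (∑-cong (suc x) split) (∑-distrib (suc x) A (B ∘ suc))) ⟩
      B 0 ⊕ (∑ (suc x) A ⊕ ∑ (suc x) (B ∘ suc))
        ≈⟨ solve 3 (λ b s t → b :+ (s :+ t) := s :+ (b :+ t)) refl (B 0) _ _ ⟩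
      ∑ (suc x) A ⊕ (B 0 ⊕ ∑ (suc x) (B ∘ suc))
        ≈⟨ +-congˡ (∑-cons (suc x) B) ⟨
      ∑ (suc x) A ⊕ ∑ (suc (suc x)) B
        ≈⟨ +-congˡ (trans (∑-snoc (suc x) B) (trans (+-congˡ B-top) (+-identityʳ _))) ⟩
      ∑ (suc x) A ⊕ ∑ (suc x) B
        ≈⟨ ∑-distrib (suc x) A B ⟨
      ∑ (suc x) (λ i → A i ⊕ B i)
        ≈⟨ ∑-cong (suc x) merge ⟩
      ∑ (suc x) (λ i → q^ (i * (i + suc m)) · (bin x i · bin (suc y) (i + suc m)))
        -- The closed form depends only on x + y and x + m, up to moving a `suc`. So one Pascal step
        -- on the first factor and one back on the second let `x` drop while `y` and `m` rise.
        ≈⟨ vandermonde x (suc y) (suc m) ⟩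
      bin (x + suc y) (x + suc m)
        ≡⟨ ≡.cong₂ bin (ℕₚ.+-suc x y) (ℕₚ.+-suc x m) ⟩
      bin (suc x + y) (suc x + m)  ∎
      where
      F A B : ℕ → Carrier
      F i = q^ (i * (i + m)) · (bin (suc x) i · bin y (i + m))
      A i = q^ (suc i * (suc i + m)) · (bin x i · bin y (suc i + m))
      B i = q^ (i * (i + m)) · (q^ i · (bin x i · bin y (i + m)))
      F₀≈B₀ : F 0 ≈ B 0
      F₀≈B₀ = *-congˡ (sym (trans (*-congʳ q^0) (*-identityˡ _)))
      split : ∀ i → F (suc i) ≈ A i ⊕ B (suc i)
      split i = solve 5 (λ e u v w z →
        e :* ((u :+ v :* w) :* z) := e :* (u :* z) :+ e :* (v :* (w :* z)))
        refl _ _ _ _ _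
      B-top : B (suc x) ≈ 0#
      B-top = trans (*-congˡ (*-congˡ (*-congʳ (bin-> (ℕₚ.n<1+n x)))))
        (solve 3 (λ a b c → a :* (b :* (con 0 :* c)) := con 0) refl _ _ _)
      expoA : ∀ i m → suc i * (suc i + m) ≡ i * (i + suc m) + suc (i + m)
      expoA = solve-∀
      expoB : ∀ i m → i * (i + m) + i ≡ i * (i + suc m)
      expoB = solve-∀
      merge : ∀ i → A i ⊕ B i ≈ q^ (i * (i + suc m)) · (bin x i · bin (suc y) (i + suc m))
      merge i = begin
        A i ⊕ B i
          ≈⟨ +-cong (sym (q^-merge _ (≡.sym (expoA i m)))) (q^-merge _ (expoB i m)) ⟩
        q^ (i * (i + suc m)) · (q^ suc (i + m) · (bin x i · bin y (suc i + m)))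
          ⊕ q^ (i * (i + suc m)) · (bin x i · bin y (i + m))
          ≈⟨ solve 5 (λ e f u v w →
            e :* (f :* (u :* v)) :+ e :* (u :* w) := e :* (u :* (w :+ f :* v)))
            refl _ _ _ _ _ ⟩
        q^ (i * (i + suc m)) · (bin x i · bin (suc y) (suc (i + m)))
          ≡⟨ ≡.cong (λ k → q^ (i * (i + suc m)) · (bin x i · bin (suc y) k)) (ℕₚ.+-suc i m) ⟨
        q^ (i * (i + suc m)) · (bin x i · bin (suc y) (i + suc m))  ∎

    -- Both sides are the q-trinomial coefficient with parts j, i and n - j - i. Working from the
    -- recurrence avoids cancelling q-factorials, which need not be invertible in the ring.
    bin-bin : ∀ n j i → bin n (j + i) · bin (j + i) j ≈ bin n j · bin (n ∸ j) i
    bin-bin n       zero    i = *-comm _ _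
    bin-bin zero    (suc j) i = trans (zeroˡ _) (sym (zeroˡ _))
    bin-bin (suc n) (suc j) i = begin
      (bin n (j + i) ⊕ q^ suc (j + i) · bin n (suc (j + i)))
        · (bin (j + i) j ⊕ q^ suc j · bin (j + i) (suc j))
        -- Next to `v` the second factor is left whole: it is `bin (suc j + i) (suc j)`, so the
        -- induction hypothesis applies to that product too.
        ≈⟨ solve 6 (λ u e v x f y →
          (u :+ e :* v) :* (x :+ f :* y)
          := u :* x :+ (e :* (v :* (x :+ f :* y)) :+ f :* (u :* y)))
          refl _ _ _ _ _ _ ⟩
      bin n (j + i) · bin (j + i) j
        ⊕ (q^ suc (j + i) · (bin n (suc j + i) · bin (suc j + i) (suc j))
          ⊕ q^ suc j · (bin n (j + i) · bin (j + i) (suc j)))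
        ≈⟨ +-cong (bin-bin n j i) (+-congʳ (*-congˡ (bin-bin n (suc j) i))) ⟩
      bin n j · bin (n ∸ j) i
        ⊕ (q^ suc (j + i) · (bin n (suc j) · bin (n ∸ suc j) i)
          ⊕ q^ suc j · (bin n (j + i) · bin (j + i) (suc j)))
        ≈⟨ +-congˡ (step i) ⟩
      bin n j · bin (n ∸ j) i ⊕ q^ suc j · (bin n (suc j) · bin (n ∸ j) i)
        ≈⟨ solve 4 (λ x e y z → x :* z :+ e :* (y :* z) := (x :+ e :* y) :* z)
          refl _ _ _ _ ⟩
      (bin n j ⊕ q^ suc j · bin n (suc j)) · bin (n ∸ j) i ∎
      where
      step : ∀ i →
        q^ suc (j + i) · (bin n (suc j) · bin (n ∸ suc j) i)
          ⊕ q^ suc j · (bin n (j + i) · bin (j + i) (suc j))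
          ≈ q^ suc j · (bin n (suc j) · bin (n ∸ j) i)
      step zero = trans
        (+-cong (*-congʳ (q^-cong (≡.cong suc (ℕₚ.+-identityʳ j))))
          (*-congˡ (*-congˡ (bin-> (s≤s (ℕₚ.≤-reflexive (ℕₚ.+-identityʳ j)))))))
        (solve 3 (λ e x y → e :* (x :* con 1) :+ e :* (y :* con 0) := e :* (x :* con 1))
          refl _ _ _)
      step (suc i) = begin
        q^ suc (j + suc i) · (b · bin (n ∸ suc j) (suc i))
          ⊕ q^ suc j · (bin n (j + suc i) · bin (j + suc i) (suc j))
          ≈⟨ +-cong (sym (q^-merge _ ≡.refl)) (*-congˡ (trans
            (reflexive (≡.cong (λ k → bin n k · bin k (suc j)) (ℕₚ.+-suc j i)))
            (bin-bin n (suc j) i))) ⟩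
        q^ suc j · (q^ suc i · (b · bin (n ∸ suc j) (suc i)))
          ⊕ q^ suc j · (b · bin (n ∸ suc j) i)
          ≈⟨ solve 5 (λ e f b x y →
            e :* (f :* (b :* x)) :+ e :* (b :* y) := e :* (b :* (y :+ f :* x)))
            refl _ _ _ _ _ ⟩
        q^ suc j · (b · bin (suc (n ∸ suc j)) (suc i))
          ≈⟨ *-congˡ top ⟩
        q^ suc j · (b · bin (n ∸ j) (suc i)) ∎
        where
        b = bin n (suc j)
        -- For n ≤ j the two tops really differ, being 1 and 0, but then `b` is zero.
        top : b · bin (suc (n ∸ suc j)) (suc i) ≈ b · bin (n ∸ j) (suc i)
        top with ℕₚ.<-≤-connex j n
        ... | inj₁ j<n = reflexive
          (≡.cong (λ k → b · bin k (suc i)) (≡.sym (ℕₚ.+-∸-assoc 1 j<n)))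
        ... | inj₂ n≤j = trans (vanish _) (sym (vanish _))
          where
          vanish : ∀ x → b · x ≈ 0#
          vanish x = trans (*-congʳ (bin-> (s≤s n≤j))) (zeroˡ x)

    -- The transformation of central q-binomial coefficients

    central-expansion : ∀ L m → bin (L + L) (L + m) ≈
      ∑ (suc L) (λ a → ∑ (suc L) (λ c →
        q^ ((a + c) * (a + c + m) + a * (a + m))
          · (bin L c · bin (L ∸ c) (a + (a + m)) · bin (a + (a + m)) a)))
    central-expansion L m = begin
      bin (L + L) (L + m)
        ≈⟨ vandermonde L L m ⟨
      ∑ (suc L) (λ A → q^ (A * (A + m)) · (bin L A · bin L (A + m)))
        ≈⟨ ∑-cong< (suc L) (λ { A (s<s A≤L) → inner A A≤L }) ⟩
      ∑ (suc L) (λ A → ∑ (suc L) (h A))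
        ≈⟨ ∑-swap (suc L) (suc L) h ⟩
      ∑ (suc L) (λ a → ∑ (suc L) (λ A → h A a))
        -- This substitutes A = a + c: `bin A a` kills A < a, and `bin L A` kills A > L.
        ≈⟨ ∑-cong (suc L) (λ a → ∑-window a (suc L) (below a) (above a)) ⟩
      ∑ (suc L) (λ a → ∑ (suc L) (λ c → h (a + c) a))
        ≈⟨ ∑-cong (suc L) (λ a → ∑-cong (suc L) (regroup a)) ⟩
      _ ∎
      where
      h : ℕ → ℕ → Carrier
      h A a = q^ (A * (A + m)) · (bin L A
        · (q^ (a * (a + m)) · (bin A a · bin (L ∸ A) (a + m))))
      -- The second convolution splits the top as L = A + (L - A), with the same `A` that the first
      -- one sums over.
      inner : ∀ A → A ≤ L →
        q^ (A * (A + m)) · (bin L A · bin L (A + m)) ≈ ∑ (suc L) (h A)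
      inner A A≤L = begin
        q^ (A * (A + m)) · (bin L A · bin L (A + m))
          ≡⟨ ≡.cong (λ n → q^ (A * (A + m)) · (bin L A · bin n (A + m))) (ℕₚ.m+[n∸m]≡n A≤L) ⟨
        q^ (A * (A + m)) · (bin L A · bin (A + (L ∸ A)) (A + m))
          ≈⟨ *-congˡ (*-congˡ (vandermonde A (L ∸ A) m)) ⟨
        q^ (A * (A + m)) · (bin L A · ∑ (suc A) f)
          ≈⟨ *-congˡ (*-congˡ (∑-extend (suc A) (L ∸ A) vanish)) ⟨
        q^ (A * (A + m)) · (bin L A · ∑ (suc A + (L ∸ A)) f)
          ≡⟨ ≡.cong (λ n → q^ (A * (A + m)) · (bin L A · ∑ (suc n) f)) (ℕₚ.m+[n∸m]≡n A≤L) ⟩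
        q^ (A * (A + m)) · (bin L A · ∑ (suc L) f)
          ≈⟨ trans (*-congˡ (∑-scale (suc L) _ f)) (∑-scale (suc L) _ (λ a → bin L A · f a)) ⟩
        ∑ (suc L) (h A) ∎
        where
        f : ℕ → Carrier
        f a = q^ (a * (a + m)) · (bin A a · bin (L ∸ A) (a + m))
        vanish : ∀ a → A < a → f a ≈ 0#
        vanish a A<a = trans (*-congˡ (trans (*-congʳ (bin-> A<a)) (zeroˡ _))) (zeroʳ _)
      below : ∀ a A → A < a → h A a ≈ 0#
      below a A A<a = trans (*-congˡ (*-congˡ (*-congˡ (*-congʳ (bin-> A<a)))))
        (solve 4 (λ x y z w → x :* (y :* (z :* (con 0 :* w))) := con 0) refl _ _ _ _)
      above : ∀ a A → L < A → h A a ≈ 0#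
      above a A L<A = trans (*-congˡ (trans (*-congʳ (bin-> L<A)) (zeroˡ _))) (zeroʳ _)
      -- Both sides are the q-multinomial coefficient of L with parts a, c, a + m and the remainder.
      -- On the right the parts a and a + m are split off last, which isolates a q-binomial
      -- coefficient with top 2a + m.
      multinomial : ∀ a c →
        bin L (a + c) · bin (a + c) a · bin (L ∸ (a + c)) (a + m)
          ≈ bin L c · bin (L ∸ c) (a + (a + m)) · bin (a + (a + m)) a
      multinomial a c = begin
        bin L (a + c) · bin (a + c) a · bin (L ∸ (a + c)) (a + m)
          ≈⟨ *-congʳ (*-congˡ (bin-sym a c)) ⟩
        bin L (a + c) · bin (a + c) c · bin (L ∸ (a + c)) (a + m)
          ≡⟨ ≡.cong (λ n → bin L n · bin n c · bin (L ∸ n) (a + m)) (ℕₚ.+-comm a c) ⟩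
        bin L (c + a) · bin (c + a) c · bin (L ∸ (c + a)) (a + m)
          ≈⟨ *-congʳ (bin-bin L c a) ⟩
        bin L c · bin (L ∸ c) a · bin (L ∸ (c + a)) (a + m)
          ≡⟨ ≡.cong (λ n → bin L c · bin (L ∸ c) a · bin n (a + m)) (ℕₚ.∸-+-assoc L c a) ⟨
        bin L c · bin (L ∸ c) a · bin (L ∸ c ∸ a) (a + m)
          ≈⟨ *-assoc _ _ _ ⟩
        bin L c · (bin (L ∸ c) a · bin (L ∸ c ∸ a) (a + m))
          ≈⟨ *-congˡ (bin-bin (L ∸ c) a (a + m)) ⟨
        bin L c · (bin (L ∸ c) (a + (a + m)) · bin (a + (a + m)) a)
          ≈⟨ *-assoc _ _ _ ⟨
        bin L c · bin (L ∸ c) (a + (a + m)) · bin (a + (a + m)) a ∎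
      regroup : ∀ a c → h (a + c) a ≈ q^ ((a + c) * (a + c + m) + a * (a + m))
        · (bin L c · bin (L ∸ c) (a + (a + m)) · bin (a + (a + m)) a)
      regroup a c = begin
        h (a + c) a
          ≈⟨ solve 5 (λ e u f v w → e :* (u :* (f :* (v :* w))) := e :* (f :* (u :* v :* w)))
            refl _ _ _ _ _ ⟩
        q^ ((a + c) * (a + c + m)) · (q^ (a * (a + m))
          · (bin L (a + c) · bin (a + c) a · bin (L ∸ (a + c)) (a + m)))
          ≈⟨ q^-merge _ ≡.refl ⟩
        q^ ((a + c) * (a + c + m) + a * (a + m))
          · (bin L (a + c) · bin (a + c) a · bin (L ∸ (a + c)) (a + m))
          ≈⟨ *-congˡ (multinomial a c) ⟩
        _ ∎

    -- No sign occurs, so a transform of polynomials with nonnegative coefficients is again one. At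
    -- e = t = 0 this is the Rogers-Ramanujan summand `q^ (c * c) · bin L c`.
    κ : ℕ → ℕ → ℕ → ℕ → Carrier
    κ e L t c = q^ (c * c + c * (t + t + e) + 2 * t * (t + e))
      · (bin L c · bin (L ∸ c) (t + t + e))

    -- The point is that κ does not depend on μ.
    transformation : ∀ e L μ →
      q^ (2 * μ * (μ + e)) · bin (L + L) (L + (μ + μ + e)) ≈
      ∑ (suc L) (λ t → ∑ (suc L) (λ c → κ e L t c · bin (t + t + e) (t + e + μ)))
    transformation e L μ = begin
      q^ (2 * μ * (μ + e)) · bin (L + L) (L + m)
        ≈⟨ *-congˡ (central-expansion L m) ⟩
      q^ (2 * μ * (μ + e)) · ∑ (suc L) (λ a → ∑ (suc L) (λ c → f a c))
        ≈⟨ ∑-scale (suc L) _ (λ a → ∑ (suc L) (f a)) ⟩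
      ∑ (suc L) (λ a → q^ (2 * μ * (μ + e)) · ∑ (suc L) (f a))
        ≈⟨ ∑-cong (suc L) (λ a → trans (∑-scale (suc L) _ (f a)) (∑-cong (suc L) (term a))) ⟩
      ∑ (suc L) (λ a → g (μ + a))
        -- The substitution t = μ + a. For t < μ the last coefficient vanishes and for t > L the
        -- kernel does, so the range of t is free of μ; this permits the interchange with a sum over
        -- j.
        ≈⟨ ∑-window μ (suc L) below above ⟨
      ∑ (suc L) g ∎
      where
      m = μ + μ + e
      f : ℕ → ℕ → Carrier
      f a c = q^ ((a + c) * (a + c + m) + a * (a + m))
        · (bin L c · bin (L ∸ c) (a + (a + m)) · bin (a + (a + m)) a)
      g : ℕ → Carrier
      g t = ∑ (suc L) (λ c → κ e L t c · bin (t + t + e) (t + e + μ))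
      top : ∀ a μ e → a + (a + (μ + μ + e)) ≡ μ + a + (μ + a) + e
      top = solve-∀
      bottom : ∀ a μ e → a + (μ + μ + e) ≡ μ + a + e + μ
      bottom = solve-∀
      -- Completing the square: with m = 2μ + e, 2μ(μ + e) + 2a(a + m) = 2t(t + e) for t = μ + a.
      -- This dictates the prefactor of `transformation`.
      expo : ∀ a c μ e →
        2 * μ * (μ + e) + ((a + c) * (a + c + (μ + μ + e)) + a * (a + (μ + μ + e)))
          ≡ c * c + c * (μ + a + (μ + a) + e) + 2 * (μ + a) * (μ + a + e)
      expo = solve-∀
      term : ∀ a c → q^ (2 * μ * (μ + e)) · f a c
        ≈ κ e L (μ + a) c · bin (μ + a + (μ + a) + e) (μ + a + e + μ)
      term a c = begin
        q^ (2 * μ * (μ + e)) · f a c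
          ≈⟨ q^-merge _ (expo a c μ e) ⟩
        q^ E · (bin L c · bin (L ∸ c) (a + (a + m)) · bin (a + (a + m)) a)
          ≈⟨ *-congˡ (*-congˡ (bin-sym a (a + m))) ⟩
        q^ E · (bin L c · bin (L ∸ c) (a + (a + m)) · bin (a + (a + m)) (a + m))
          ≡⟨ ≡.cong₂ (λ n k → q^ E · (bin L c · bin (L ∸ c) n · bin n k)) (top a μ e) (bottom a μ e) ⟩
        q^ E · (bin L c · bin (L ∸ c) (μ + a + (μ + a) + e) · bin (μ + a + (μ + a) + e) (μ + a + e + μ))
          ≈⟨ *-assoc _ _ _ ⟨
        κ e L (μ + a) c · bin (μ + a + (μ + a) + e) (μ + a + e + μ) ∎
        where
        E = c * c + c * (μ + a + (μ + a) + e) + 2 * (μ + a) * (μ + a + e)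
      below : ∀ t → t < μ → g t ≈ 0#
      below t t<μ = ∑-zero (suc L) (λ c → trans (*-congˡ (bin-> (≡.subst
        (_< t + e + μ) (reorder t e) (ℕₚ.+-monoʳ-< (t + e) t<μ)))) (zeroʳ _))
        where
        reorder : ∀ t e → t + e + t ≡ t + t + e
        reorder = solve-∀
      above : ∀ t → L < t → g t ≈ 0#
      above t L<t = ∑-zero (suc L) (λ c → trans (*-congʳ (trans (*-congˡ
        (trans (*-congˡ (bin-> (beyond c))) (zeroʳ _))) (zeroʳ _))) (zeroˡ _))
        where
        beyond : ∀ c → L ∸ c < t + t + e
        beyond c = ℕₚ.≤-<-trans (ℕₚ.m∸n≤m L c)
          (ℕₚ.<-≤-trans L<t (ℕₚ.≤-trans (ℕₚ.m≤m+n t t) (ℕₚ.m≤m+n (t + t) e)))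

    transform : ℕ → ℕ → (ℕ → Carrier) → Carrier
    transform e L h = ∑ (suc L) (λ t → ∑ (suc L) (λ c → κ e L t c · h t))

    transform-cong : ∀ e L {h h′} → (∀ t → t ≤ L → h t ≈ h′ t) →
                     transform e L h ≈ transform e L h′
    transform-cong e L h≈h′ = ∑-cong< (suc L) (λ { t (s<s t≤L) →
      ∑-cong (suc L) (λ c → *-congˡ (h≈h′ t t≤L)) })

    transform-scale : ∀ e L x h → x · transform e L h ≈ transform e L (λ t → x · h t)
    transform-scale e L x h = trans
      (∑-scale (suc L) x (λ t → ∑ (suc L) (λ c → κ e L t c · h t)))
      (∑-cong (suc L) (λ t → trans (∑-scale (suc L) x (λ c → κ e L t c · h t))
        (∑-cong (suc L) (λ c →
          solve 3 (λ x y z → x :* (y :* z) := y :* (x :* z)) refl _ _ _))))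

    transform-+ : ∀ e L h h′ →
      transform e L h ⊕ transform e L h′ ≈ transform e L (λ t → h t ⊕ h′ t)
    transform-+ e L h h′ = trans
      (sym (∑-distrib (suc L) (λ t → ∑ (suc L) (λ c → κ e L t c · h t)) _))
      (∑-cong (suc L) (λ t → trans
        (sym (∑-distrib (suc L) (λ c → κ e L t c · h t) (λ c → κ e L t c · h′ t)))
        (∑-cong (suc L) (λ c → sym (distribˡ _ _ _)))))

    transform-∑ : ∀ e L N (h : ℕ → ℕ → Carrier) →
      ∑ N (λ k → transform e L (h k)) ≈ transform e L (λ t → ∑ N (λ k → h k t))
    transform-∑ e L N h = trans
      (∑-swap N (suc L) (λ k t → ∑ (suc L) (λ c → κ e L t c · h k t)))
      (∑-cong (suc L) (λ t → trans
        (∑-swap N (suc L) (λ k c → κ e L t c · h k t))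
        (∑-cong (suc L) (λ c → sym (∑-scale N (κ e L t c) (λ k → h k t))))))

    transform-δ : ∀ e L {h} → (∀ t → t < L → h (suc t) ≈ 0#) →
      transform e L h ≈ ∑ (suc L) (λ c → κ e L 0 c · h 0)
    transform-δ e L h≈0 = trans (∑-cons L _) (trans (+-congˡ (trans
      (∑-cong< L (λ t t<L → ∑-zero (suc L) (λ c →
        trans (*-congˡ (h≈0 t t<L)) (zeroʳ _))))
      (∑-zero L (λ _ → refl)))) (+-identityʳ _))

    -- Alternating sums

    -- Subtraction is written as adding a multiple of ε, so that the solver for
    -- commutative semirings applies.
    ε : Carrier
    ε = - 1#

    ε-cancel : ∀ x → x ⊕ ε · x ≈ 0#
    ε-cancel x = begin
      x ⊕ ε · x       ≈⟨ +-congʳ (*-identityˡ x) ⟨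
      1# · x ⊕ ε · x  ≈⟨ distribʳ x 1# ε ⟨
      (1# ⊕ ε) · x    ≈⟨ *-congʳ (-‿inverseʳ 1#) ⟩
      0# · x          ≈⟨ zeroˡ x ⟩
      0#              ∎

    ε² : ∀ x → ε · (ε · x) ≈ x
    ε² x = begin
      ε · (ε · x)              ≈⟨ +-identityˡ _ ⟨
      0# ⊕ ε · (ε · x)         ≈⟨ +-congʳ (ε-cancel x) ⟨
      x ⊕ ε · x ⊕ ε · (ε · x)  ≈⟨ +-assoc _ _ _ ⟩
      x ⊕ (ε · x ⊕ ε · (ε · x)) ≈⟨ +-congˡ (ε-cancel (ε · x)) ⟩
      x ⊕ 0#                   ≈⟨ +-identityʳ x ⟩
      x                        ∎

    sgn : ℕ → Carrier
    sgn zero    = 1#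
    sgn (suc k) = ε · sgn k

    -- A sum over -N ≤ j < N with sign (-1)^j: the term j = k ≥ 0 is given by a and
    -- u, the term j = -1 - k by b and v.
    opaque

      θ : ℕ → ℕ → (a u b v : ℕ → ℕ) → Carrier
      θ N n a u b v = ∑ N (λ k →
        sgn k · (q^ a k · bin n (u k) ⊕ ε · (q^ b k · bin n (v k))))

      θ-def : ∀ {N n a u b v} → θ N n a u b v ≈
        ∑ N (λ k → sgn k · (q^ a k · bin n (u k) ⊕ ε · (q^ b k · bin n (v k))))
      θ-def = refl

      θ-cong : ∀ N {n n′} {a u b v a′ u′ b′ v′} → n ≡ n′ →
        (∀ k → a k ≡ a′ k) → (∀ k → u k ≡ u′ k) →
        (∀ k → b k ≡ b′ k) → (∀ k → v k ≡ v′ k) →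
        θ N n a u b v ≈ θ N n′ a′ u′ b′ v′
      θ-cong N {n} ≡.refl a≡ u≡ b≡ v≡ = ∑-cong N (λ k → *-congˡ (+-cong
        (*-cong (q^-cong (a≡ k)) (reflexive (≡.cong (bin n) (u≡ k))))
        (*-congˡ (*-cong (q^-cong (b≡ k)) (reflexive (≡.cong (bin n) (v≡ k)))))))

    -- Linearity carries `transformation` through the alternating sum, with `μ` for the half j ≥ 0
    -- and `ν` for the half j < 0. The exponents `a` and `b` are what remains once the prefactors
    -- are split off.
    θ-transform : ∀ N e L a b (μ ν : ℕ → ℕ) →
      θ N (L + L)
        (λ k → 2 * μ k * (μ k + e) + a k) (λ k → L + (μ k + μ k + e))
        (λ k → 2 * ν k * (ν k + e) + b k) (λ k → L + (ν k + ν k + e))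
      ≈ transform e L (λ t → θ N (t + t + e)
        a (λ k → t + e + μ k) b (λ k → t + e + ν k))
    θ-transform N e L a b μ ν = trans (trans θ-def (∑-cong N term))
      (trans (transform-∑ e L N (λ k t → sgn k · (f a μ k t ⊕ ε · f b ν k t)))
        (transform-cong e L (λ t _ → sym θ-def)))
      where
      f : (ℕ → ℕ) → (ℕ → ℕ) → ℕ → ℕ → Carrier
      f a μ k t = q^ a k · bin (t + t + e) (t + e + μ k)
      half : ∀ a μ k →
        q^ (2 * μ k * (μ k + e) + a k) · bin (L + L) (L + (μ k + μ k + e))
          ≈ transform e L (f a μ k)
      half a μ k = begin
        _ ≈⟨ q^-merge _ (ℕₚ.+-comm (a k) _) ⟨
        q^ a k · (q^ (2 * μ k * (μ k + e)) · bin (L + L) (L + (μ k + μ k + e)))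
          ≈⟨ *-congˡ (transformation e L (μ k)) ⟩
        q^ a k · transform e L (λ t → bin (t + t + e) (t + e + μ k))
          ≈⟨ transform-scale e L (q^ a k) (λ t → bin (t + t + e) (t + e + μ k)) ⟩
        transform e L (f a μ k) ∎
      term : ∀ k → _ ≈ transform e L (λ t → sgn k · (f a μ k t ⊕ ε · f b ν k t))
      term k = begin
        _ ≈⟨ *-congˡ (+-cong (half a μ k) (*-congˡ (half b ν k))) ⟩
        sgn k · (transform e L (f a μ k) ⊕ ε · transform e L (f b ν k))
          ≈⟨ *-congˡ (+-congˡ (transform-scale e L ε (f b ν k))) ⟩
        sgn k · (transform e L (f a μ k) ⊕ transform e L (λ t → ε · f b ν k t))
          ≈⟨ *-congˡ (transform-+ e L (f a μ k) (λ t → ε · f b ν k t)) ⟩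
        sgn k · transform e L (λ t → f a μ k t ⊕ ε · f b ν k t)
          ≈⟨ transform-scale e L (sgn k) (λ t → f a μ k t ⊕ ε · f b ν k t) ⟩
        transform e L (λ t → sgn k · (f a μ k t ⊕ ε · f b ν k t)) ∎

    ∑-front : ∀ N f → f N ≈ 0# → ∑ N f ≈ f 0 ⊕ ∑ N (f ∘ suc)
    ∑-front N f fN≈0 = begin
      ∑ N f          ≈⟨ +-identityʳ _ ⟨
      ∑ N f ⊕ 0#     ≈⟨ +-congˡ fN≈0 ⟨
      ∑ N f ⊕ f N    ≈⟨ ∑-snoc N f ⟨
      ∑ (suc N) f    ≈⟨ ∑-cons N f ⟩
      f 0 ⊕ ∑ N (f ∘ suc) ∎

    ∑-telescope : ∀ N g → g N ≈ 0# → ∑ N (λ k → g k ⊕ ε · g (suc k)) ≈ g 0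
    ∑-telescope N g gN≈0 = begin
      ∑ N (λ k → g k ⊕ ε · g (suc k))
        ≈⟨ ∑-distrib N g (λ k → ε · g (suc k)) ⟩
      ∑ N g ⊕ ∑ N (λ k → ε · g (suc k))
        ≈⟨ +-cong (∑-front N g gN≈0) (sym (∑-scale N ε (g ∘ suc))) ⟩
      g 0 ⊕ ∑ N (g ∘ suc) ⊕ ε · ∑ N (g ∘ suc)
        ≈⟨ +-assoc _ _ _ ⟩
      g 0 ⊕ (∑ N (g ∘ suc) ⊕ ε · ∑ N (g ∘ suc))
        ≈⟨ +-congˡ (ε-cancel _) ⟩
      g 0 ⊕ 0#
        ≈⟨ +-identityʳ _ ⟩
      g 0 ∎

    -- Both sides are the same bilateral sum: the terms with index 0 ≤ k and
    -- k < 0 are paired as (k , -1 - k) on one side, as (-k , k + 1) on the other.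
    θ-pairing : ∀ N n a b u → a 0 ≡ b 0 → bin n (u N) ≈ 0# →
      θ N n a u (b ∘ suc) (u ∘ suc) ≈ θ N n b u (a ∘ suc) (u ∘ suc)
    θ-pairing N n a b u a₀≡b₀ uN≈0 = begin
      θ N n a u (b ∘ suc) (u ∘ suc)
        ≈⟨ rewritten a b ⟩
      f a 0 ⊕ ∑ N (f a ∘ suc) ⊕ ∑ N (f b ∘ suc)
        ≈⟨ solve 3 (λ x y z → x :+ y :+ z := x :+ z :+ y) refl _ _ _ ⟩
      f a 0 ⊕ ∑ N (f b ∘ suc) ⊕ ∑ N (f a ∘ suc)
        ≈⟨ +-congʳ (+-congʳ (*-congˡ (*-congʳ (q^-cong a₀≡b₀)))) ⟩
      f b 0 ⊕ ∑ N (f b ∘ suc) ⊕ ∑ N (f a ∘ suc)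
        ≈⟨ rewritten b a ⟨
      θ N n b u (a ∘ suc) (u ∘ suc) ∎
      where
      f : (ℕ → ℕ) → ℕ → Carrier
      f a k = sgn k · (q^ a k · bin n (u k))
      rewritten : ∀ a b →
        θ N n a u (b ∘ suc) (u ∘ suc) ≈ f a 0 ⊕ ∑ N (f a ∘ suc) ⊕ ∑ N (f b ∘ suc)
      rewritten a b = begin
        θ N n a u (b ∘ suc) (u ∘ suc)
          ≈⟨ trans θ-def (∑-cong N (λ k → solve 4 (λ s x e y →
            s :* (x :+ e :* y) := s :* x :+ e :* s :* y) refl _ _ _ _)) ⟩
        ∑ N (λ k → f a k ⊕ f b (suc k))
          ≈⟨ ∑-distrib N (f a) (f b ∘ suc) ⟩
        ∑ N (f a) ⊕ ∑ N (f b ∘ suc)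
          ≈⟨ +-congʳ (∑-front N (f a) (trans (*-congˡ (trans (*-congˡ uN≈0) (zeroʳ _))) (zeroʳ _))) ⟩
        f a 0 ⊕ ∑ N (f a ∘ suc) ⊕ ∑ N (f b ∘ suc) ∎

    -- The telescoping sum and the Rogers-Ramanujan sums

    tri : ℕ → ℕ
    tri zero    = 0
    tri (suc k) = suc k + tri k

    -- Truncation does no harm: k(k - 1)/2 is 0 at k = 0 too, so `tri (k ∸ 1)` stands for it at
    -- every k.
    tri-∸1 : ∀ k → tri (k ∸ 1) + k ≡ tri k
    tri-∸1 zero    = ≡.refl
    tri-∸1 (suc k) = ℕₚ.+-comm (tri k) (suc k)

    -- The factor `q^ k` turns the exponent x - k of `pascalʳ` into x, which is constant in k and
    -- can leave a sum over k. For k > x the term concerned is zero.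
    pascalʳ-central : ∀ x d k →
      q^ k · bin (suc (x + d)) (suc (d + k))
        ≈ q^ x · bin (x + d) (d + k) ⊕ q^ k · bin (x + d) (suc (d + k))
    pascalʳ-central x d k = begin
      q^ k · bin (suc (x + d)) (suc (d + k))
        ≈⟨ *-congˡ (pascalʳ (x + d) (d + k)) ⟩
      q^ k · (q^ (x + d ∸ (d + k)) · bin (x + d) (d + k) ⊕ bin (x + d) (suc (d + k)))
        ≈⟨ distribˡ _ _ _ ⟩
      q^ k · (q^ (x + d ∸ (d + k)) · bin (x + d) (d + k)) ⊕ q^ k · bin (x + d) (suc (d + k))
        ≈⟨ +-congʳ merge ⟩
      q^ x · bin (x + d) (d + k) ⊕ q^ k · bin (x + d) (suc (d + k)) ∎
      where
      expo : x + d ∸ (d + k) ≡ x ∸ k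
      expo = ≡.trans (≡.cong (_∸ (d + k)) (ℕₚ.+-comm x d)) (ℕₚ.[m+n]∸[m+o]≡n∸o d x k)
      merge : q^ k · (q^ (x + d ∸ (d + k)) · bin (x + d) (d + k)) ≈ q^ x · bin (x + d) (d + k)
      merge with ℕₚ.≤-<-connex k x
      ... | inj₁ k≤x = q^-merge _ (≡.trans (≡.cong (k +_) expo) (ℕₚ.m+[n∸m]≡n k≤x))
      ... | inj₂ x<k = trans (trans (*-congˡ (vanish _)) (zeroʳ _)) (sym (vanish _))
        where
        vanish : ∀ y → y · bin (x + d) (d + k) ≈ 0#
        vanish y = trans (*-congˡ (bin-> (≡.subst (_< d + k) (ℕₚ.+-comm d x)
          (ℕₚ.+-monoʳ-< d x<k)))) (zeroʳ y)

    -- δ N t , A N t , … are sums over all j ∈ ℤ of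
    --   (-1)^j q^(j(j+1)/2)  [2t , t-j]      (δ)
    --   (-1)^j q^(j(5j+1)/2) [2t , t-2j]     (A)
    --   (-1)^j q^(j(5j+1)/2) [2t+1 , t-2j]   (A′)
    --   (-1)^j q^(j(5j+3)/2) [2t+1 , t-2j]   (B)
    -- truncated to -N ≤ j < N, which loses nothing when t < N.
    δ A A′ B : ℕ → ℕ → Carrier
    δ N t  = θ N (t + t) tri (λ k → t + k) tri (λ k → t + suc k)
    A N t  = θ N (t + t)
      (λ k → 2 * (k * k) + tri k)         (λ k → t + (k + k))
      (λ k → 2 * (suc k * suc k) + tri k) (λ k → t + (suc k + suc k))
    A′ N t = θ N (t + t + 1)
      (λ k → 2 * (k * k) + tri k)         (λ k → t + 1 + (k + k))
      (λ k → 2 * (suc k * suc k) + tri k) (λ k → t + 1 + (k + k + 1))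
    B N t  = θ N (t + t + 1)
      (λ k → 2 * (k * k) + k + tri k)         (λ k → t + 1 + (k + k))
      (λ k → 2 * (k * k) + 3 * k + 1 + tri k) (λ k → t + 1 + (k + k + 1))

    δ-zero : ∀ N → 0 < N → δ N 0 ≈ 1#
    δ-zero (suc N) _ = begin
      δ (suc N) 0
        ≈⟨ trans θ-def (∑-cons N _) ⟩
      1# · (q^ 0 · 1# ⊕ ε · (q^ 0 · 0#)) ⊕ ∑ N (λ k → sgn (suc k) · (q^ tri (suc k) · 0# ⊕ ε · (q^ tri (suc k) · 0#)))
        ≈⟨ +-cong (*-congˡ (+-congʳ (*-congʳ q^0))) (∑-zero N (λ k →
          solve 3 (λ s x e → s :* (x :* con 0 :+ e :* (x :* con 0)) := con 0) refl _ _ ε)) ⟩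
      1# · (1# · 1# ⊕ ε · (q^ 0 · 0#)) ⊕ 0#
        ≈⟨ solve 2 (λ e x → con 1 :* (con 1 :* con 1 :+ e :* (x :* con 0)) :+ con 0 := con 1) refl ε (q^ 0) ⟩
      1# ∎

    -- One Pascal rule for j = k and the other for j = -1 - k produce a common term, which cancels.
    -- What remains is a constant power of q times `g k` minus `g (k + 2)`. Since this telescopes in
    -- steps of two, `h` adds neighbouring values of `g` to reduce it to steps of one. At the lower
    -- end `h 0` vanishes by the symmetry of the coefficients with top 2t + 1.
    δ-suc : ∀ N t → suc t < N → δ N (suc t) ≈ 0#
    δ-suc N t t<N = begin
      δ N (suc t)
        ≡⟨ ≡.cong (λ n → θ N n tri (λ k → suc t + k) tri (λ k → suc t + suc k)) (ℕₚ.+-suc (suc t) t) ⟩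
      θ N (suc m) tri (λ k → suc (t + k)) tri (λ k → suc (t + suc k))
        ≈⟨ trans θ-def (∑-cong N term) ⟩
      ∑ N (λ k → q^ suc t · (h k ⊕ ε · h (suc k)))
        ≈⟨ ∑-scale N _ (λ k → h k ⊕ ε · h (suc k)) ⟨
      q^ suc t · ∑ N (λ k → h k ⊕ ε · h (suc k))
        ≈⟨ *-congˡ (∑-telescope N h hN≈0) ⟩
      q^ suc t · h 0
        ≈⟨ *-congˡ h0≈0 ⟩
      q^ suc t · 0#
        ≈⟨ zeroʳ _ ⟩
      0# ∎
      where
      m = suc t + t
      y g h : ℕ → Carrier
      y k = bin m (t + k)
      g k = sgn k · (q^ tri (k ∸ 1) · y k)
      h k = g k ⊕ g (suc k)
      y-> : ∀ k → suc t < k → y k ≈ 0#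
      y-> k t<k = bin-> (≡.subst (_< t + k) (ℕₚ.+-comm t (suc t)) (ℕₚ.+-monoʳ-< t t<k))
      hN≈0 : h N ≈ 0#
      hN≈0 = trans (+-cong
        (trans (*-congˡ (trans (*-congˡ (y-> N t<N)) (zeroʳ _))) (zeroʳ _))
        (trans (*-congˡ (trans (*-congˡ (y-> (suc N) (ℕₚ.m<n⇒m<1+n t<N))) (zeroʳ _))) (zeroʳ _)))
        (+-identityˡ _)
      y₀≈y₁ : y 0 ≈ y 1
      y₀≈y₁ = begin
        bin m (t + 0)  ≡⟨ ≡.cong (bin m) (ℕₚ.+-identityʳ t) ⟩
        bin m t        ≈⟨ bin-sym (suc t) t ⟨
        bin m (suc t)  ≡⟨ ≡.cong (bin m) (ℕₚ.+-comm 1 t) ⟩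
        bin m (t + 1)  ∎
      h0≈0 : h 0 ≈ 0#
      h0≈0 = begin
        1# · (q^ 0 · y 0) ⊕ ε · 1# · (q^ 0 · y 1)
          ≈⟨ +-congˡ (*-congˡ (*-congˡ y₀≈y₁)) ⟨
        1# · (q^ 0 · y 0) ⊕ ε · 1# · (q^ 0 · y 0)
          ≈⟨ solve 3 (λ e x y → con 1 :* (x :* y) :+ e :* con 1 :* (x :* y) := x :* y :+ e :* (x :* y)) refl ε _ _ ⟩
        q^ 0 · y 0 ⊕ ε · (q^ 0 · y 0)
          ≈⟨ ε-cancel _ ⟩
        0# ∎
      expo : ∀ t k r → r + suc (t + suc k) ≡ suc t + (suc k + r)
      expo = solve-∀
      left : ∀ k → q^ tri k · bin (suc m) (suc (t + k))
        ≈ q^ suc t · (q^ tri (k ∸ 1) · y k) ⊕ q^ tri k · y (suc k)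
      left k = begin
        q^ tri k · bin (suc m) (suc (t + k))
          ≈⟨ q^-merge _ (tri-∸1 k) ⟨
        q^ tri (k ∸ 1) · (q^ k · bin (suc m) (suc (t + k)))
          ≈⟨ *-congˡ (pascalʳ-central (suc t) t k) ⟩
        q^ tri (k ∸ 1) · (q^ suc t · y k ⊕ q^ k · bin m (suc (t + k)))
          ≈⟨ solve 5 (λ a b y c z → a :* (b :* y :+ c :* z) := b :* (a :* y) :+ a :* (c :* z)) refl _ _ _ _ _ ⟩
        q^ suc t · (q^ tri (k ∸ 1) · y k) ⊕ q^ tri (k ∸ 1) · (q^ k · bin m (suc (t + k)))
          ≈⟨ +-congˡ (trans (q^-merge _ (tri-∸1 k))
            (*-congˡ (reflexive (≡.cong (bin m) (≡.sym (ℕₚ.+-suc t k)))))) ⟩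
        q^ suc t · (q^ tri (k ∸ 1) · y k) ⊕ q^ tri k · y (suc k) ∎
      right : ∀ k → q^ tri k · bin (suc m) (suc (t + suc k))
        ≈ q^ tri k · y (suc k) ⊕ q^ suc t · (q^ tri (suc k) · y (suc (suc k)))
      right k = begin
        q^ tri k · (y (suc k) ⊕ q^ suc (t + suc k) · bin m (suc (t + suc k)))
          ≈⟨ distribˡ _ _ _ ⟩
        q^ tri k · y (suc k) ⊕ q^ tri k · (q^ suc (t + suc k) · bin m (suc (t + suc k)))
          ≈⟨ +-congˡ (trans (q^-exchange _ (expo t k (tri k)))
            (*-congˡ (*-congˡ (reflexive (≡.cong (bin m) (≡.sym (ℕₚ.+-suc t (suc k)))))))) ⟩
        q^ tri k · y (suc k) ⊕ q^ suc t · (q^ tri (suc k) · y (suc (suc k))) ∎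
      term : ∀ k →
        sgn k · (q^ tri k · bin (suc m) (suc (t + k)) ⊕ ε · (q^ tri k · bin (suc m) (suc (t + suc k))))
          ≈ q^ suc t · (h k ⊕ ε · h (suc k))
      term k = begin
        _ ≈⟨ *-congˡ (+-cong (left k) (*-congˡ (right k))) ⟩
        s · (p · u ⊕ v ⊕ ε · (v ⊕ p · w))
          ≈⟨ solve 6 (λ s p u v e w →
            s :* (p :* u :+ v :+ e :* (v :+ p :* w))
            := s :* (v :+ e :* v) :+ p :* (s :* u :+ s :* (e :* w)))
            refl s p u v ε w ⟩
        s · (v ⊕ ε · v) ⊕ p · (s · u ⊕ s · (ε · w))
          -- The two extra signs turn the coefficient of `w` into that of `g (suc (suc k))`.
          ≈⟨ +-cong (trans (*-congˡ (ε-cancel v)) (zeroʳ s))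
            (*-congˡ (+-congˡ (*-congˡ (*-congˡ (sym (ε² w)))))) ⟩
        0# ⊕ p · (s · u ⊕ s · (ε · (ε · (ε · w))))
          ≈⟨ solve 5 (λ s p u e w →
            con 0 :+ p :* (s :* u :+ s :* (e :* (e :* (e :* w))))
            := p :* (s :* u :+ e :* (e :* (e :* s) :* w)))
            refl s p u ε w ⟩
        p · (s · u ⊕ ε · (ε · (ε · s) · w))
          ≈⟨ *-congˡ (+-congʳ (+-identityʳ _)) ⟨
        p · (s · u ⊕ 0# ⊕ ε · (ε · (ε · s) · w))
          -- `ε · s · v` is `g (suc k)`, inserted together with its negative to complete `h k` and
          -- `h (suc k)`.
          ≈⟨ *-congˡ (+-congʳ (+-congˡ (ε-cancel (ε · s · v)))) ⟨
        p · (s · u ⊕ (ε · s · v ⊕ ε · (ε · s · v)) ⊕ ε · (ε · (ε · s) · w))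
          ≈⟨ solve 6 (λ p x y z e w →
            p :* (x :+ (y :+ e :* y) :+ e :* w) := p :* (x :+ y :+ e :* (y :+ w)))
            refl p (s · u) (ε · s · v) v ε (ε · (ε · s) · w) ⟩
        q^ suc t · (h k ⊕ ε · h (suc k)) ∎
        where
        s = sgn k
        p = q^ suc t
        u = q^ tri (k ∸ 1) · y k
        v = q^ tri k · y (suc k)
        w = q^ tri (suc k) · y (suc (suc k))

    -- Finite forms of the sum sides of the two Rogers-Ramanujan identities (e = 0 and e = 1): as s
    -- grows, `bin s c` tends to 1/(q)_c.
    rr : ℕ → ℕ → Carrier
    rr e s = ∑ (suc s) (λ c → q^ (c * c + c * e) · bin s c)

    -- Here μ is |j|, so the prefactor takes 2j² from j(5j + 1)/2 and leaves the exponent of `δ`.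
    -- Hence only t = 0 survives in the transform.
    A≈rr : ∀ N s → s < N → A N s ≈ rr 0 s
    A≈rr N s s<N = begin
      A N s
        ≈⟨ θ-cong N ≡.refl (λ k → expo k (tri k)) (λ k → index s k) (λ k → expo (suc k) (tri k)) (λ k → index s (suc k)) ⟩
      _ ≈⟨ θ-transform N 0 s tri tri (λ k → k) suc ⟩
      _ ≈⟨ transform-cong 0 s (λ t _ → θ-cong N (ℕₚ.+-identityʳ (t + t))
        (λ _ → ≡.refl) (λ k → ≡.cong (_+ k) (ℕₚ.+-identityʳ t))
        (λ _ → ≡.refl) (λ k → ≡.cong (_+ suc k) (ℕₚ.+-identityʳ t))) ⟩
      transform 0 s (δ N)
        ≈⟨ transform-δ 0 s (λ t t<s → δ-suc N t (ℕₚ.≤-<-trans t<s s<N)) ⟩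
      ∑ (suc s) (λ c → κ 0 s 0 c · δ N 0)
        ≈⟨ ∑-cong (suc s) (λ c → trans (*-congˡ (δ-zero N (ℕₚ.≤-<-trans z≤n s<N)))
          (trans (*-identityʳ _) (*-cong (q^-cong (ℕₚ.+-identityʳ _)) (*-identityʳ _)))) ⟩
      rr 0 s ∎
      where
      expo : ∀ k r → 2 * (k * k) + r ≡ 2 * k * (k + 0) + r
      expo = solve-∀
      index : ∀ s k → s + (k + k) ≡ s + (k + k + 0)
      index = solve-∀

    θ-odd : ∀ N s (u v : ℕ → ℕ) {a b} →
      θ N (s + s + 1) a (λ k → s + 1 + u k) b (λ k → s + 1 + v k) ≈
      ∑ N (λ k → sgn k · (q^ a k · bin (suc (s + s)) (suc (s + u k))
                   ⊕ ε · (q^ b k · bin (suc (s + s)) (suc (s + v k)))))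
    θ-odd N s u v = trans (θ-cong N (ℕₚ.+-comm (s + s) 1)
      (λ _ → ≡.refl) (λ k → ≡.cong (_+ u k) (ℕₚ.+-comm s 1))
      (λ _ → ≡.refl) (λ k → ≡.cong (_+ v k) (ℕₚ.+-comm s 1))) θ-def

    -- Opposite Pascal rules on the two members of each pair yield the same middle term `z`, with
    -- opposite signs.
    A′≈A : ∀ N s → A′ N s ≈ A N s
    A′≈A N s = begin
      A′ N s
        ≈⟨ trans (θ-odd N s (λ k → k + k) (λ k → k + k + 1)) (∑-cong N term) ⟩
      ∑ N (λ k → sgn k · (q^ (2 * (k * k) + tri k) · β (k + k)
                   ⊕ ε · (q^ (2 * (suc k * suc k) + tri k) · β (suc k + suc k))))
        ≈⟨ θ-def ⟨
      A N s ∎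
      where
      β : ℕ → Carrier
      β k = bin (s + s) (s + k)
      expoˡ : ∀ s k r → 2 * (k * k) + r + suc (s + (k + k)) ≡ 2 * (k * k) + 2 * k + 1 + r + s
      expoˡ = solve-∀
      expoʳ : ∀ k r → 2 * (k * k) + 2 * k + 1 + r + (k + k + 1) ≡ 2 * (suc k * suc k) + r
      expoʳ = solve-∀
      index : ∀ s k → suc (s + (k + k + 1)) ≡ s + (suc k + suc k)
      index = solve-∀
      term : ∀ k →
        sgn k · (q^ (2 * (k * k) + tri k) · bin (suc (s + s)) (suc (s + (k + k)))
          ⊕ ε · (q^ (2 * (suc k * suc k) + tri k) · bin (suc (s + s)) (suc (s + (k + k + 1)))))
        ≈ sgn k · (q^ (2 * (k * k) + tri k) · β (k + k)
          ⊕ ε · (q^ (2 * (suc k * suc k) + tri k) · β (suc k + suc k)))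
      term k = begin
        _ ≈⟨ *-congˡ (+-cong left (*-congˡ right)) ⟩
        sgn k · (x ⊕ z ⊕ ε · (z ⊕ y))
          ≈⟨ solve 5 (λ s x z e y → s :* (x :+ z :+ e :* (z :+ y))
            := s :* ((z :+ e :* z) :+ (x :+ e :* y))) refl _ x z ε y ⟩
        sgn k · ((z ⊕ ε · z) ⊕ (x ⊕ ε · y))
          ≈⟨ *-congˡ (trans (+-congʳ (ε-cancel z)) (+-identityˡ _)) ⟩
        sgn k · (x ⊕ ε · y) ∎
        where
        -- Chosen so that the exponent at j = -1 - k is d + (2k + 1), leaving exactly the factor
        -- that `pascalʳ-central` needs.
        d = 2 * (k * k) + 2 * k + 1 + tri k
        x = q^ (2 * (k * k) + tri k) · β (k + k)
        y = q^ (2 * (suc k * suc k) + tri k) · β (suc k + suc k)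
        z = q^ (d + s) · β (k + k + 1)
        left : q^ (2 * (k * k) + tri k) · bin (suc (s + s)) (suc (s + (k + k))) ≈ x ⊕ z
        left = trans (distribˡ _ _ _) (+-congˡ (trans (q^-merge _ (expoˡ s k (tri k)))
          (*-congˡ (reflexive (≡.cong (bin (s + s)) (shift s k))))))
          where
          shift : ∀ s k → suc (s + (k + k)) ≡ s + (k + k + 1)
          shift = solve-∀
        right : q^ (2 * (suc k * suc k) + tri k) · bin (suc (s + s)) (suc (s + (k + k + 1))) ≈ z ⊕ y
        right = begin
          _ ≈⟨ q^-merge _ (expoʳ k (tri k)) ⟨
          q^ d · (q^ (k + k + 1) · bin (suc (s + s)) (suc (s + (k + k + 1))))
            ≈⟨ *-congˡ (pascalʳ-central s s (k + k + 1)) ⟩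
          q^ d · (q^ s · β (k + k + 1) ⊕ q^ (k + k + 1) · bin (s + s) (suc (s + (k + k + 1))))
            ≈⟨ distribˡ _ _ _ ⟩
          q^ d · (q^ s · β (k + k + 1)) ⊕ q^ d · (q^ (k + k + 1) · bin (s + s) (suc (s + (k + k + 1))))
            ≈⟨ +-cong (q^-merge _ ≡.refl) (trans (q^-merge _ (expoʳ k (tri k)))
              (*-congˡ (reflexive (≡.cong (bin (s + s)) (index s k))))) ⟩
          z ⊕ y ∎

    -- Evaluation of B through two auxiliary sums

    bin-central-> : ∀ t k → t < k → bin (t + t) (t + k) ≈ 0#
    bin-central-> t k t<k = bin-> (ℕₚ.+-monoʳ-< t t<k)

    -- The sum over j of (-1)^j q^(j(j-1)/2) [2t+1 , t-j], truncated like `δ`.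
    D : ℕ → ℕ → Carrier
    D N t = θ N (t + t + 1) (λ k → tri (k ∸ 1)) (λ k → t + 1 + k)
                            (λ k → tri (suc k)) (λ k → t + 1 + k)

    -- After Pascal, the terms without the factor q^(t+1) form `δ` with j replaced by -j, which
    -- `θ-pairing` undoes; those with the factor form `δ` directly, with the opposite sign.
    D≈ : ∀ N t → t < N → D N t ≈ δ N t ⊕ ε · (q^ suc t · δ N t)
    D≈ N t t<N = begin
      D N t
        ≈⟨ trans (θ-odd N t (λ k → k) (λ k → k)) (∑-cong N term) ⟩
      ∑ N (λ k → f k ⊕ ε · (q^ suc t · g k))
        ≈⟨ ∑-distrib N f (λ k → ε · (q^ suc t · g k)) ⟩
      ∑ N f ⊕ ∑ N (λ k → ε · (q^ suc t · g k))
        ≈⟨ +-cong θ-def (trans (*-congˡ (∑-scale N _ g)) (∑-scale N ε (λ k → q^ suc t · g k))) ⟨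
      θ N (t + t) (λ k → tri (k ∸ 1)) (λ k → t + k) (λ k → tri (suc k)) (λ k → t + suc k)
        ⊕ ε · (q^ suc t · ∑ N g)
        ≈⟨ +-cong (θ-pairing N (t + t) tri (λ k → tri (k ∸ 1)) (λ k → t + k) ≡.refl
          (bin-central-> t N t<N)) (*-congˡ (*-congˡ θ-def)) ⟨
      δ N t ⊕ ε · (q^ suc t · δ N t) ∎
      where
      β f g : ℕ → Carrier
      β k = bin (t + t) (t + k)
      f k = sgn k · (q^ tri (k ∸ 1) · β k ⊕ ε · (q^ tri (suc k) · β (suc k)))
      g k = sgn k · (q^ tri k · β k ⊕ ε · (q^ tri k · β (suc k)))
      expoˡ : ∀ t k r → r + suc (t + k) ≡ suc t + (r + k)
      expoˡ = solve-∀
      expoʳ : ∀ k r → suc r + k ≡ suc k + r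
      expoʳ = solve-∀
      expoᵐ : ∀ t r → suc r + t ≡ suc t + r
      expoᵐ = solve-∀
      left : ∀ k → q^ tri (k ∸ 1) · bin (suc (t + t)) (suc (t + k))
        ≈ q^ tri (k ∸ 1) · β k ⊕ q^ suc t · (q^ tri k · β (suc k))
      left k = trans (distribˡ _ _ _) (+-congˡ (trans
        (q^-exchange _ (≡.trans (expoˡ t k (tri (k ∸ 1))) (≡.cong (suc t +_) (tri-∸1 k))))
        (*-congˡ (*-congˡ (reflexive (≡.cong (bin (t + t)) (≡.sym (ℕₚ.+-suc t k))))))))
      right : ∀ k → q^ tri (suc k) · bin (suc (t + t)) (suc (t + k))
        ≈ q^ suc t · (q^ tri k · β k) ⊕ q^ tri (suc k) · β (suc k)
      right k = begin
        _ ≈⟨ q^-merge _ (expoʳ k (tri k)) ⟨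
        q^ suc (tri k) · (q^ k · bin (suc (t + t)) (suc (t + k)))
          ≈⟨ *-congˡ (pascalʳ-central t t k) ⟩
        q^ suc (tri k) · (q^ t · β k ⊕ q^ k · bin (t + t) (suc (t + k)))
          ≈⟨ distribˡ _ _ _ ⟩
        q^ suc (tri k) · (q^ t · β k) ⊕ q^ suc (tri k) · (q^ k · bin (t + t) (suc (t + k)))
          ≈⟨ +-cong (q^-exchange _ (expoᵐ t (tri k))) (trans (q^-merge _ (expoʳ k (tri k)))
            (*-congˡ (reflexive (≡.cong (bin (t + t)) (≡.sym (ℕₚ.+-suc t k)))))) ⟩
        q^ suc t · (q^ tri k · β k) ⊕ q^ tri (suc k) · β (suc k) ∎
      term : ∀ k →
        sgn k · (q^ tri (k ∸ 1) · bin (suc (t + t)) (suc (t + k))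
          ⊕ ε · (q^ tri (suc k) · bin (suc (t + t)) (suc (t + k))))
        ≈ f k ⊕ ε · (q^ suc t · g k)
      term k = begin
        _ ≈⟨ *-congˡ (+-cong (left k) (*-congˡ (right k))) ⟩
        s · (x ⊕ p · v ⊕ ε · (p · u ⊕ w))
          ≈⟨ *-congˡ (+-congʳ (+-congˡ (ε² (p · v)))) ⟨
        s · (x ⊕ ε · (ε · (p · v)) ⊕ ε · (p · u ⊕ w))
          ≈⟨ solve 7 (λ s x e p v u w →
            s :* (x :+ e :* (e :* (p :* v)) :+ e :* (p :* u :+ w))
            := s :* (x :+ e :* w) :+ e :* (p :* (s :* (u :+ e :* v))))
            refl s x ε p v u w ⟩
        f k ⊕ ε · (q^ suc t · g k) ∎
        where
        s = sgn k
        p = q^ suc t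
        x = q^ tri (k ∸ 1) · β k
        u = q^ tri k · β k
        v = q^ tri k · β (suc k)
        w = q^ tri (suc k) · β (suc k)

    -- The sum over j of (-1)^j q^(j(5j+3)/2) [2s , s-2j-1]. Its top is even and its offset odd, so
    -- the transformation with e = 1 applies and leads to `D`.
    C : ℕ → ℕ → Carrier
    C N s = θ N (s + s)
      (λ k → 2 * k * (k + 1) + tri (k ∸ 1)) (λ k → s + (k + k + 1))
      (λ k → 2 * k * (k + 1) + tri (suc k)) (λ k → s + (k + k + 1))

    C≈ : ∀ N s → s < N → C N s ≈ ∑ (suc s) (λ c → κ 1 s 0 c · (1# ⊕ ε · q^ 1))
    C≈ N s s<N = begin
      C N s
        ≈⟨ θ-transform N 1 s (λ k → tri (k ∸ 1)) (λ k → tri (suc k)) (λ k → k) (λ k → k) ⟩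
      transform 1 s (D N)
        ≈⟨ transform-cong 1 s (λ t t≤s → D≈ N t (ℕₚ.≤-<-trans t≤s s<N)) ⟩
      transform 1 s (λ t → δ N t ⊕ ε · (q^ suc t · δ N t))
        ≈⟨ transform-δ 1 s (λ t t<s → trans
          (+-cong (δ-suc N t (ℕₚ.≤-<-trans t<s s<N))
            (*-congˡ (*-congˡ (δ-suc N t (ℕₚ.≤-<-trans t<s s<N)))))
          (solve 2 (λ e x → con 0 :+ e :* (x :* con 0) := con 0) refl ε _)) ⟩
      ∑ (suc s) (λ c → κ 1 s 0 c · (δ N 0 ⊕ ε · (q^ 1 · δ N 0)))
        ≈⟨ ∑-cong (suc s) (λ c → *-congˡ (+-cong δ≈1 (*-congˡ (trans (*-congˡ δ≈1) (*-identityʳ _))))) ⟩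
      ∑ (suc s) (λ c → κ 1 s 0 c · (1# ⊕ ε · q^ 1)) ∎
      where
      δ≈1 = δ-zero N (ℕₚ.≤-<-trans z≤n s<N)

    -- Lowering the odd top by Pascal leaves coefficients with even offsets, all carrying q^s and
    -- forming `A` with j replaced by -j, and coefficients with odd offsets, which form `C`.
    B≈A+C : ∀ N s → s < N → B N s ≈ q^ s · A N s ⊕ C N s
    B≈A+C N s s<N = begin
      B N s
        ≈⟨ trans (θ-odd N s (λ k → k + k) (λ k → k + k + 1)) (∑-cong N term) ⟩
      ∑ N (λ k → q^ s · f k ⊕ g k)
        ≈⟨ trans (∑-distrib N (λ k → q^ s · f k) g) (+-congʳ (sym (∑-scale N _ f))) ⟩
      q^ s · ∑ N f ⊕ ∑ N g
        ≈⟨ +-cong (*-congˡ θ-def) θ-def ⟨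
      q^ s · θ N (s + s) b u (a ∘ suc) (u ∘ suc) ⊕ C N s
        ≈⟨ +-congʳ (*-congˡ (θ-pairing N (s + s) a b u ≡.refl
          (bin-central-> s (N + N) (ℕₚ.<-≤-trans s<N (ℕₚ.m≤m+n N N))))) ⟨
      q^ s · A N s ⊕ C N s ∎
      where
      a b u : ℕ → ℕ
      a k = 2 * (k * k) + tri k
      b k = 2 * (k * k) + tri (k ∸ 1)
      u k = s + (k + k)
      β f g : ℕ → Carrier
      β k = bin (s + s) (s + k)
      f k = sgn k · (q^ b k · β (k + k) ⊕ ε · (q^ a (suc k) · β (suc k + suc k)))
      g k = sgn k · (q^ (2 * k * (k + 1) + tri (k ∸ 1)) · β (k + k + 1)
            ⊕ ε · (q^ (2 * k * (k + 1) + tri (suc k)) · β (k + k + 1)))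
      index : ∀ s k → suc (s + (k + k)) ≡ s + (k + k + 1)
      index = solve-∀
      index′ : ∀ s k → suc (s + (k + k + 1)) ≡ s + (suc k + suc k)
      index′ = solve-∀
      expo₁ : ∀ k r → 2 * (k * k) + r + (k + k) ≡ 2 * (k * k) + k + (r + k)
      expo₁ = solve-∀
      expo₂ : ∀ k r → 2 * (k * k) + r + (k + k) ≡ 2 * k * (k + 1) + r
      expo₂ = solve-∀
      expo₃ : ∀ k r → 2 * (k * k) + 3 * k + 1 + r ≡ 2 * k * (k + 1) + (suc k + r)
      expo₃ = solve-∀
      expo₄ : ∀ s k r → 2 * (k * k) + 3 * k + 1 + r + suc (s + (k + k + 1))
                      ≡ s + (2 * (suc k * suc k) + (suc k + r))
      expo₄ = solve-∀
      left : ∀ k → q^ (2 * (k * k) + k + tri k) · bin (suc (s + s)) (suc (s + (k + k)))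
        ≈ q^ s · (q^ b k · β (k + k)) ⊕ q^ (2 * k * (k + 1) + tri (k ∸ 1)) · β (k + k + 1)
      left k = begin
        _ ≈⟨ q^-merge _ (≡.trans (expo₁ k (tri (k ∸ 1)))
          (≡.cong (2 * (k * k) + k +_) (tri-∸1 k))) ⟨
        q^ b k · (q^ (k + k) · bin (suc (s + s)) (suc (s + (k + k))))
          ≈⟨ *-congˡ (pascalʳ-central s s (k + k)) ⟩
        q^ b k · (q^ s · β (k + k) ⊕ q^ (k + k) · bin (s + s) (suc (s + (k + k))))
          ≈⟨ solve 5 (λ a b y c z → a :* (b :* y :+ c :* z) := b :* (a :* y) :+ a :* (c :* z))
            refl _ _ _ _ _ ⟩
        q^ s · (q^ b k · β (k + k)) ⊕ q^ b k · (q^ (k + k) · bin (s + s) (suc (s + (k + k))))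
          ≈⟨ +-congˡ (trans (q^-merge _ (expo₂ k (tri (k ∸ 1))))
            (*-congˡ (reflexive (≡.cong (bin (s + s)) (index s k))))) ⟩
        q^ s · (q^ b k · β (k + k)) ⊕ q^ (2 * k * (k + 1) + tri (k ∸ 1)) · β (k + k + 1) ∎
      right : ∀ k → q^ (2 * (k * k) + 3 * k + 1 + tri k) · bin (suc (s + s)) (suc (s + (k + k + 1)))
        ≈ q^ (2 * k * (k + 1) + tri (suc k)) · β (k + k + 1) ⊕ q^ s · (q^ a (suc k) · β (suc k + suc k))
      right k = trans (distribˡ _ _ _) (+-cong (*-congʳ (q^-cong (expo₃ k (tri k))))
        (trans (q^-exchange _ (expo₄ s k (tri k)))
          (*-congˡ (*-congˡ (reflexive (≡.cong (bin (s + s)) (index′ s k)))))))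
      term : ∀ k →
        sgn k · (q^ (2 * (k * k) + k + tri k) · bin (suc (s + s)) (suc (s + (k + k)))
          ⊕ ε · (q^ (2 * (k * k) + 3 * k + 1 + tri k) · bin (suc (s + s)) (suc (s + (k + k + 1)))))
        ≈ q^ s · f k ⊕ g k
      term k = trans (*-congˡ (+-cong (left k) (*-congˡ (right k))))
        (solve 7 (λ s p x y e z w →
          s :* ((p :* x :+ y) :+ e :* (z :+ p :* w))
          := p :* (s :* (x :+ e :* w)) :+ s :* (y :+ e :* z))
          refl (sgn k) (q^ s) _ _ ε _ _)

    bin-1 : ∀ n → bin n 1 · (1# ⊕ ε · q^ 1) ≈ 1# ⊕ ε · q^ n
    bin-1 zero    = begin
      0# · (1# ⊕ ε · q^ 1)  ≈⟨ zeroˡ _ ⟩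
      0#                    ≈⟨ ε-cancel 1# ⟨
      1# ⊕ ε · 1#           ≈⟨ +-congˡ (*-congˡ q^0) ⟨
      1# ⊕ ε · q^ 0         ∎
    bin-1 (suc n) = begin
      (1# ⊕ q^ 1 · bin n 1) · (1# ⊕ ε · q^ 1)
        ≈⟨ solve 3 (λ x b e → (con 1 :+ x :* b) :* (con 1 :+ e :* x)
          := con 1 :+ e :* x :+ x :* (b :* (con 1 :+ e :* x))) refl (q^ 1) _ ε ⟩
      1# ⊕ ε · q^ 1 ⊕ q^ 1 · (bin n 1 · (1# ⊕ ε · q^ 1))
        ≈⟨ +-congˡ (*-congˡ (bin-1 n)) ⟩
      1# ⊕ ε · q^ 1 ⊕ q^ 1 · (1# ⊕ ε · q^ n)
        ≈⟨ solve 3 (λ x y e → con 1 :+ e :* x :+ x :* (con 1 :+ e :* y)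
          := (x :+ e :* x) :+ (con 1 :+ e :* (x :* y))) refl (q^ 1) _ ε ⟩
      (q^ 1 ⊕ ε · q^ 1) ⊕ (1# ⊕ ε · (q^ 1 · q^ n))
        ≈⟨ +-cong (ε-cancel _) (+-congˡ (*-congˡ (sym (q^-+ 1 n)))) ⟩
      0# ⊕ (1# ⊕ ε · q^ suc n)
        ≈⟨ +-identityˡ _ ⟩
      1# ⊕ ε · q^ suc n ∎

    -- By `bin-1` the factor 1 - q in `C≈` becomes 1 - q^(s-c). As c² + c + (s - c) = s + c², the
    -- negative part is exactly the contribution q^s times `rr 0 s` of `A`, and the two cancel.
    B≈rr : ∀ N s → s < N → B N s ≈ rr 1 s
    B≈rr N s s<N = begin
      B N s
        ≈⟨ B≈A+C N s s<N ⟩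
      q^ s · A N s ⊕ C N s
        ≈⟨ +-cong (*-congˡ (A≈rr N s s<N)) (C≈ N s s<N) ⟩
      q^ s · rr 0 s ⊕ ∑ (suc s) g
        ≈⟨ +-congʳ (∑-scale (suc s) _ f) ⟩
      ∑ (suc s) (λ c → q^ s · f c) ⊕ ∑ (suc s) g
        ≈⟨ ∑-distrib (suc s) (λ c → q^ s · f c) g ⟨
      ∑ (suc s) (λ c → q^ s · f c ⊕ g c)
        ≈⟨ ∑-cong< (suc s) (λ { c (s<s c≤s) → term c c≤s }) ⟩
      rr 1 s ∎
      where
      f g : ℕ → Carrier
      f c = q^ (c * c + c * 0) · bin s c
      g c = κ 1 s 0 c · (1# ⊕ ε · q^ 1)
      expo : ∀ c r → c * c + c * 1 + r ≡ c + r + (c * c + c * 0)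
      expo = solve-∀
      g≈ : ∀ c → c ≤ s → g c ≈ q^ (c * c + c * 1) · bin s c ⊕ ε · (q^ s · f c)
      g≈ c c≤s = begin
        g c
          ≈⟨ solve 4 (λ p b x y → p :* (b :* x) :* y := p :* (b :* (x :* y))) refl _ _ _ _ ⟩
        q^ (c * c + c * 1 + 0) · (bin s c · (bin (s ∸ c) 1 · (1# ⊕ ε · q^ 1)))
          ≈⟨ *-cong (q^-cong (ℕₚ.+-identityʳ _)) (*-congˡ (bin-1 (s ∸ c))) ⟩
        q^ (c * c + c * 1) · (bin s c · (1# ⊕ ε · q^ (s ∸ c)))
          ≈⟨ solve 4 (λ p b e x → p :* (b :* (con 1 :+ e :* x)) := p :* b :+ e :* (p :* (x :* b)))
            refl _ _ ε _ ⟩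
        q^ (c * c + c * 1) · bin s c ⊕ ε · (q^ (c * c + c * 1) · (q^ (s ∸ c) · bin s c))
          ≈⟨ +-congˡ (*-congˡ (q^-exchange _ (≡.trans (expo c (s ∸ c))
            (≡.cong (_+ (c * c + c * 0)) (ℕₚ.m+[n∸m]≡n c≤s))))) ⟩
        q^ (c * c + c * 1) · bin s c ⊕ ε · (q^ s · f c) ∎
      term : ∀ c → c ≤ s → q^ s · f c ⊕ g c ≈ q^ (c * c + c * 1) · bin s c
      term c c≤s = begin
        q^ s · f c ⊕ g c
          ≈⟨ +-congˡ (g≈ c c≤s) ⟩
        q^ s · f c ⊕ (q^ (c * c + c * 1) · bin s c ⊕ ε · (q^ s · f c))
          ≈⟨ solve 3 (λ x y z → x :+ (y :+ z) := y :+ (x :+ z)) refl _ _ _ ⟩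
        q^ (c * c + c * 1) · bin s c ⊕ (q^ s · f c ⊕ ε · (q^ s · f c))
          ≈⟨ trans (+-congˡ (ε-cancel _)) (+-identityʳ _) ⟩
        q^ (c * c + c * 1) · bin s c ∎

    -- The three sums of the theorem (with -1 - j paired with j ≥ 0), as images
    -- of A, B and A′ under the transformation.
    first-sum : ∀ N L → L < N →
      θ N (L + L)
        (λ k → 10 * (k * k) + tri k)         (λ k → L + 4 * k)
        (λ k → 10 * (suc k * suc k) + tri k) (λ k → L + 4 * suc k)
      ≈ transform 0 L (rr 0)
    first-sum N L L<N = begin
      _ ≈⟨ θ-cong N ≡.refl (λ k → expo k (tri k)) (index L) (λ k → expo (suc k) (tri k)) (λ k → index L (suc k)) ⟩
      _ ≈⟨ θ-transform N 0 L (λ k → 2 * (k * k) + tri k) (λ k → 2 * (suc k * suc k) + tri k)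
        (λ k → k + k) (λ k → suc k + suc k) ⟩
      _ ≈⟨ transform-cong 0 L (λ t t≤L → trans (θ-cong N (ℕₚ.+-identityʳ (t + t))
        (λ _ → ≡.refl) (λ k → ≡.cong (_+ (k + k)) (ℕₚ.+-identityʳ t))
        (λ _ → ≡.refl) (λ k → ≡.cong (_+ (suc k + suc k)) (ℕₚ.+-identityʳ t)))
        (A≈rr N t (ℕₚ.≤-<-trans t≤L L<N))) ⟩
      transform 0 L (rr 0) ∎
      where
      expo : ∀ k r → 10 * (k * k) + r ≡ 2 * (k + k) * (k + k + 0) + (2 * (k * k) + r)
      expo = solve-∀
      index : ∀ L k → L + 4 * k ≡ L + (k + k + (k + k) + 0)
      index = solve-∀

    second-sum : ∀ N L → L < N →
      θ N (L + L)
        (λ k → 10 * (k * k) + 5 * k + tri k)      (λ k → L + 1 + 4 * k)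
        (λ k → 10 * (k * k) + 15 * k + 5 + tri k) (λ k → L + 3 + 4 * k)
      ≈ transform 1 L (rr 1)
    second-sum N L L<N = begin
      _ ≈⟨ θ-cong N ≡.refl (λ k → expoˡ k (tri k)) (indexˡ L) (λ k → expoʳ k (tri k)) (indexʳ L) ⟩
      -- For j = -1 - k the offset 4j + 1 has absolute value 4k + 3 = 2(2k + 1) + 1, whence the odd
      -- value 2k + 1 on the negative half.
      _ ≈⟨ θ-transform N 1 L (λ k → 2 * (k * k) + k + tri k) (λ k → 2 * (k * k) + 3 * k + 1 + tri k)
        (λ k → k + k) (λ k → k + k + 1) ⟩
      _ ≈⟨ transform-cong 1 L (λ t t≤L → B≈rr N t (ℕₚ.≤-<-trans t≤L L<N)) ⟩
      transform 1 L (rr 1) ∎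
      where
      expoˡ : ∀ k r → 10 * (k * k) + 5 * k + r ≡ 2 * (k + k) * (k + k + 1) + (2 * (k * k) + k + r)
      expoˡ = solve-∀
      expoʳ : ∀ k r → 10 * (k * k) + 15 * k + 5 + r
        ≡ 2 * (k + k + 1) * (k + k + 1 + 1) + (2 * (k * k) + 3 * k + 1 + r)
      expoʳ = solve-∀
      indexˡ : ∀ L k → L + 1 + 4 * k ≡ L + (k + k + (k + k) + 1)
      indexˡ = solve-∀
      indexʳ : ∀ L k → L + 3 + 4 * k ≡ L + (k + k + 1 + (k + k + 1) + 1)
      indexʳ = solve-∀

    third-sum : ∀ N L → L < N →
      θ N (L + L)
        (λ k → 10 * (k * k) + 4 * k + tri k)      (λ k → L + 1 + 4 * k)
        (λ k → 10 * (k * k) + 16 * k + 6 + tri k) (λ k → L + 3 + 4 * k)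
      ≈ transform 1 L (rr 0)
    third-sum N L L<N = begin
      _ ≈⟨ θ-cong N ≡.refl (λ k → expoˡ k (tri k)) (indexˡ L) (λ k → expoʳ k (tri k)) (indexʳ L) ⟩
      _ ≈⟨ θ-transform N 1 L (λ k → 2 * (k * k) + tri k) (λ k → 2 * (suc k * suc k) + tri k)
        (λ k → k + k) (λ k → k + k + 1) ⟩
      _ ≈⟨ transform-cong 1 L (λ t t≤L → trans (A′≈A N t)
        (A≈rr N t (ℕₚ.≤-<-trans t≤L L<N))) ⟩
      transform 1 L (rr 0) ∎
      where
      expoˡ : ∀ k r → 10 * (k * k) + 4 * k + r ≡ 2 * (k + k) * (k + k + 1) + (2 * (k * k) + r)
      expoˡ = solve-∀
      expoʳ : ∀ k r → 10 * (k * k) + 16 * k + 6 + r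
        ≡ 2 * (k + k + 1) * (k + k + 1 + 1) + (2 * (suc k * suc k) + r)
      expoʳ = solve-∀
      indexˡ : ∀ L k → L + 1 + 4 * k ≡ L + (k + k + (k + k) + 1)
      indexˡ = solve-∀
      indexʳ : ∀ L k → L + 3 + 4 * k ≡ L + (k + k + 1 + (k + k + 1) + 1)
      indexʳ = solve-∀

    -- Agreement with the quotient of q-factorials

    ⟨q⟩ᴿ : ℕ → Carrier
    ⟨q⟩ᴿ zero    = 1#
    ⟨q⟩ᴿ (suc m) = ⟨q⟩ᴿ m · (1# ⊕ ε · q^ suc m)

    -- The induction rests on (1 - q^(m+1)) + q^(m+1) (1 - q^(n+1)) = 1 - q^(m+n+2).
    bin-⟨q⟩ : ∀ m n → bin (m + n) m · (⟨q⟩ᴿ m · ⟨q⟩ᴿ n) ≈ ⟨q⟩ᴿ (m + n)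
    bin-⟨q⟩ zero    n       = trans (*-identityˡ _) (*-identityˡ _)
    bin-⟨q⟩ (suc m) zero    = begin
      bin (suc m + 0) (suc m) · (⟨q⟩ᴿ (suc m) · 1#)
        ≡⟨ ≡.cong (λ k → bin k (suc m) · (⟨q⟩ᴿ (suc m) · 1#)) (ℕₚ.+-identityʳ (suc m)) ⟩
      bin (suc m) (suc m) · (⟨q⟩ᴿ (suc m) · 1#)
        ≈⟨ *-cong (sym (bin-diag (suc m))) (*-identityʳ _) ⟩
      1# · ⟨q⟩ᴿ (suc m)
        ≈⟨ *-identityˡ _ ⟩
      ⟨q⟩ᴿ (suc m)
        ≡⟨ ≡.cong ⟨q⟩ᴿ (ℕₚ.+-identityʳ (suc m)) ⟨
      ⟨q⟩ᴿ (suc m + 0) ∎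
    bin-⟨q⟩ (suc m) (suc n) = begin
      (b₀ ⊕ q^ suc m · b₁) · (⟨q⟩ᴿ m · x · (⟨q⟩ᴿ n · y))
        ≈⟨ solve 7 (λ b₀ p b₁ f x g y →
          (b₀ :+ p :* b₁) :* (f :* x :* (g :* y))
          := b₀ :* (f :* (g :* y)) :* x :+ p :* (b₁ :* (f :* x :* g)) :* y)
          refl b₀ (q^ suc m) b₁ (⟨q⟩ᴿ m) x (⟨q⟩ᴿ n) y ⟩
      b₀ · (⟨q⟩ᴿ m · ⟨q⟩ᴿ (suc n)) · x ⊕ q^ suc m · (b₁ · (⟨q⟩ᴿ (suc m) · ⟨q⟩ᴿ n)) · y
        ≈⟨ +-cong (*-congʳ (bin-⟨q⟩ m (suc n))) (*-congʳ (*-congˡ shifted)) ⟩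
      ⟨q⟩ᴿ (m + suc n) · x ⊕ q^ suc m · ⟨q⟩ᴿ (m + suc n) · y
        ≈⟨ solve 4 (λ f p e r →
          f :* (con 1 :+ e :* p) :+ p :* f :* (con 1 :+ e :* r)
          := f :* (con 1 :+ (p :+ e :* p) :+ e :* (p :* r)))
          refl (⟨q⟩ᴿ (m + suc n)) (q^ suc m) ε (q^ suc n) ⟩
      ⟨q⟩ᴿ (m + suc n) · (1# ⊕ (q^ suc m ⊕ ε · q^ suc m) ⊕ ε · (q^ suc m · q^ suc n))
        ≈⟨ *-congˡ (+-cong (trans (+-congˡ (ε-cancel _)) (+-identityʳ _))
          (*-congˡ (sym (q^-+ (suc m) (suc n))))) ⟩
      ⟨q⟩ᴿ (m + suc n) · (1# ⊕ ε · q^ suc (m + suc n)) ∎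
      where
      b₀ = bin (m + suc n) m
      b₁ = bin (m + suc n) (suc m)
      x = 1# ⊕ ε · q^ suc m
      y = 1# ⊕ ε · q^ suc n
      shifted : b₁ · (⟨q⟩ᴿ (suc m) · ⟨q⟩ᴿ n) ≈ ⟨q⟩ᴿ (m + suc n)
      shifted = ≡.subst (λ k → bin k (suc m) · (⟨q⟩ᴿ (suc m) · ⟨q⟩ᴿ n) ≈ ⟨q⟩ᴿ k)
        (≡.sym (ℕₚ.+-suc m n)) (bin-⟨q⟩ (suc m) n)

-- Formal power series over ℤ

open import Algebra.Properties.CommutativeMonoid.Sum ℤₚ.+-0-commutativeMonoid
  using (sum; sum-cong-≗)
open import Data.Integer.Base using (+_)
open import Data.Product.Base using (_×_; _,_; ∃-syntax)
open import Defs
open ≡ using (_≢_; _≗_; refl; sym; trans; cong; cong₂; subst; module ≡-Reasoning)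

module SeriesRing where

  open import Data.Nat.Base using (_+_; _<_)

  infixl 6 _+ₛ_

  _+ₛ_ : Series → Series → Series
  (a +ₛ b) n = a n ℤ.+ b n

  -ₛ_ : Series → Series
  (-ₛ a) n = ℤ.- a n

  -- Coefficient `suc n` of `a *ₛ b` unfolds to `a 0 ℤ.* b (suc n)` plus coefficient `n` of
  -- `tail a *ₛ b`, so the ring laws follow by induction on the coefficient with `a` varying.
  tail : Series → Series
  tail a n = a (suc n)

  *ₛ-cong : ∀ {a a′ b b′} → a ≗ a′ → b ≗ b′ → a *ₛ b ≗ a′ *ₛ b′
  *ₛ-cong a≗ b≗ zero    = cong (ℤ._+ 0ℤ) (cong₂ ℤ._*_ (a≗ 0) (b≗ 0))
  *ₛ-cong a≗ b≗ (suc n) = cong₂ ℤ._+_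
    (cong₂ ℤ._*_ (a≗ 0) (b≗ (suc n))) (*ₛ-cong (a≗ ∘ suc) b≗ n)

  *ₛ-distribʳ : ∀ c a b → (a +ₛ b) *ₛ c ≗ a *ₛ c +ₛ b *ₛ c
  *ₛ-distribʳ c a b zero    = expand (a 0) (b 0) (c 0)
    where
    expand : ∀ x y z → (x ℤ.+ y) ℤ.* z ℤ.+ 0ℤ ≡ x ℤ.* z ℤ.+ 0ℤ ℤ.+ (y ℤ.* z ℤ.+ 0ℤ)
    expand = ℤ-Solver.solve-∀
  *ₛ-distribʳ c a b (suc n) = trans
    (cong (λ z → (a 0 ℤ.+ b 0) ℤ.* c (suc n) ℤ.+ z) (*ₛ-distribʳ c (tail a) (tail b) n))
    (expand (a 0) (b 0) (c (suc n)) _ _)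
    where
    expand : ∀ x y z u v → (x ℤ.+ y) ℤ.* z ℤ.+ (u ℤ.+ v) ≡ x ℤ.* z ℤ.+ u ℤ.+ (y ℤ.* z ℤ.+ v)
    expand = ℤ-Solver.solve-∀

  *ₛ-scaleˡ : ∀ x a b → (λ k → x ℤ.* a k) *ₛ b ≗ λ n → x ℤ.* (a *ₛ b) n
  *ₛ-scaleˡ x a b zero    = expand x (a 0) (b 0)
    where
    expand : ∀ x y z → x ℤ.* y ℤ.* z ℤ.+ 0ℤ ≡ x ℤ.* (y ℤ.* z ℤ.+ 0ℤ)
    expand = ℤ-Solver.solve-∀
  *ₛ-scaleˡ x a b (suc n) = trans
    (cong (λ z → x ℤ.* a 0 ℤ.* b (suc n) ℤ.+ z) (*ₛ-scaleˡ x (tail a) b n))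
    (expand x (a 0) (b (suc n)) _)
    where
    expand : ∀ x y z u → x ℤ.* y ℤ.* z ℤ.+ x ℤ.* u ≡ x ℤ.* (y ℤ.* z ℤ.+ u)
    expand = ℤ-Solver.solve-∀

  *ₛ-zeroˡ : ∀ a → 0ₛ *ₛ a ≗ 0ₛ
  *ₛ-zeroˡ a zero    = refl
  *ₛ-zeroˡ a (suc n) = trans (ℤₚ.+-identityˡ _) (*ₛ-zeroˡ a n)

  *ₛ-identityˡ : ∀ a → q^ 0 *ₛ a ≗ a
  *ₛ-identityˡ a zero    = trans (ℤₚ.+-identityʳ _) (ℤₚ.*-identityˡ (a 0))
  *ₛ-identityˡ a (suc n) = trans
    (cong₂ ℤ._+_ (ℤₚ.*-identityˡ (a (suc n))) (*ₛ-zeroˡ a n)) (ℤₚ.+-identityʳ _)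

  -- The mirror image of the unfolding of `*ₛ`, which is the induction step of commutativity.
  *ₛ-sucʳ : ∀ a b n → (a *ₛ b) (suc n) ≡ (a *ₛ tail b) n ℤ.+ a (suc n) ℤ.* b 0
  *ₛ-sucʳ a b zero    = reorder (a 0) (b 1) (a 1) (b 0)
    where
    reorder : ∀ x y z u → x ℤ.* y ℤ.+ (z ℤ.* u ℤ.+ 0ℤ) ≡ x ℤ.* y ℤ.+ 0ℤ ℤ.+ z ℤ.* u
    reorder = ℤ-Solver.solve-∀
  *ₛ-sucʳ a b (suc n) = trans
    (cong (λ z → a 0 ℤ.* b (suc (suc n)) ℤ.+ z) (*ₛ-sucʳ (tail a) b n))
    (sym (ℤₚ.+-assoc (a 0 ℤ.* b (suc (suc n))) _ _))

  *ₛ-comm : ∀ a b → a *ₛ b ≗ b *ₛ a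
  *ₛ-comm a b zero    = cong (ℤ._+ 0ℤ) (ℤₚ.*-comm (a 0) (b 0))
  *ₛ-comm a b (suc n) = begin
    a 0 ℤ.* b (suc n) ℤ.+ (tail a *ₛ b) n
      ≡⟨ cong₂ ℤ._+_ (ℤₚ.*-comm (a 0) _) (*ₛ-comm (tail a) b n) ⟩
    b (suc n) ℤ.* a 0 ℤ.+ (b *ₛ tail a) n
      ≡⟨ ℤₚ.+-comm (b (suc n) ℤ.* a 0) _ ⟩
    (b *ₛ tail a) n ℤ.+ b (suc n) ℤ.* a 0
      ≡⟨ *ₛ-sucʳ b a n ⟨
    (b *ₛ a) (suc n) ∎
    where open ≡-Reasoning

  *ₛ-assoc : ∀ a b c → (a *ₛ b) *ₛ c ≗ a *ₛ (b *ₛ c)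
  *ₛ-assoc a b c zero    = reassoc (a 0) (b 0) (c 0)
    where
    reassoc : ∀ x y z → (x ℤ.* y ℤ.+ 0ℤ) ℤ.* z ℤ.+ 0ℤ ≡ x ℤ.* (y ℤ.* z ℤ.+ 0ℤ) ℤ.+ 0ℤ
    reassoc = ℤ-Solver.solve-∀
  *ₛ-assoc a b c (suc n) = begin
    (a *ₛ b) 0 ℤ.* c (suc n) ℤ.+ (((λ k → a 0 ℤ.* b (suc k)) +ₛ tail a *ₛ b) *ₛ c) n
      ≡⟨ cong (λ z → (a *ₛ b) 0 ℤ.* c (suc n) ℤ.+ z)
        (*ₛ-distribʳ c (λ k → a 0 ℤ.* b (suc k)) (tail a *ₛ b) n) ⟩
    (a *ₛ b) 0 ℤ.* c (suc n)
      ℤ.+ (((λ k → a 0 ℤ.* b (suc k)) *ₛ c) n ℤ.+ ((tail a *ₛ b) *ₛ c) n)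
      ≡⟨ cong (λ z → (a *ₛ b) 0 ℤ.* c (suc n) ℤ.+ z)
        (cong₂ ℤ._+_ (*ₛ-scaleˡ (a 0) (tail b) c n) (*ₛ-assoc (tail a) b c n)) ⟩
    (a *ₛ b) 0 ℤ.* c (suc n) ℤ.+ (a 0 ℤ.* (tail b *ₛ c) n ℤ.+ (tail a *ₛ (b *ₛ c)) n)
      ≡⟨ reassoc (a 0) (b 0) (c (suc n)) _ _ ⟩
    (a *ₛ (b *ₛ c)) (suc n) ∎
    where
    open ≡-Reasoning
    reassoc : ∀ x y z u v →
      (x ℤ.* y ℤ.+ 0ℤ) ℤ.* z ℤ.+ (x ℤ.* u ℤ.+ v) ≡ x ℤ.* (y ℤ.* z ℤ.+ u) ℤ.+ v
    reassoc = ℤ-Solver.solve-∀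

  seriesRing : CommutativeRing 0ℓ 0ℓ
  seriesRing = record
    { Carrier = Series ; _≈_ = _≗_ ; _+_ = _+ₛ_ ; _*_ = _*ₛ_ ; -_ = -ₛ_
    ; 0# = 0ₛ ; 1# = q^ 0
    ; isCommutativeRing = record
      { isRing = record
        { +-isAbelianGroup = Pointwise.isAbelianGroup ℕ ℤₚ.+-0-isAbelianGroup
        ; *-cong = *ₛ-cong
        ; *-assoc = *ₛ-assoc
        ; *-identity = *ₛ-identityˡ ,
            λ a n → trans (*ₛ-comm a (q^ 0) n) (*ₛ-identityˡ a n)
        ; distrib = (λ c a b n → trans (*ₛ-comm c (a +ₛ b) n) (trans (*ₛ-distribʳ c a b n)
            (cong₂ ℤ._+_ (*ₛ-comm a c n) (*ₛ-comm b c n)))) , *ₛ-distribʳ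
        }
      ; *-comm = *ₛ-comm
      }
    }

  q^-shift : ∀ e a n → (q^ e *ₛ a) (e + n) ≡ a n
  q^-shift zero    a n = *ₛ-identityˡ a n
  q^-shift (suc e) a n = trans (ℤₚ.+-identityˡ _) (q^-shift e a n)

  q^-shift-< : ∀ e a n → n < e → (q^ e *ₛ a) n ≡ 0ℤ
  q^-shift-< (suc e) a zero    _         = refl
  q^-shift-< (suc e) a (suc n) (s<s n<e) = trans (ℤₚ.+-identityˡ _) (q^-shift-< e a n n<e)

  q^-+ : ∀ a b → q^ (a + b) ≗ q^ a *ₛ q^ b
  q^-+ zero    b n       = sym (*ₛ-identityˡ (q^ b) n)
  q^-+ (suc a) b zero    = refl
  q^-+ (suc a) b (suc n) = trans (q^-+ a b n) (sym (ℤₚ.+-identityˡ _))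

  ÷ₛ-congˡ : ∀ {a a′} b → a ≗ a′ → a ÷ₛ b ≗ a′ ÷ₛ b
  ÷ₛ-congˡ b a≗ zero    = a≗ 0
  ÷ₛ-congˡ b a≗ (suc n) = ÷ₛ-congˡ b (λ k →
    cong₂ (λ x y → x ℤ.- y ℤ.* b (suc k)) (a≗ (suc k)) (a≗ 0)) n

  -- With `÷ₛ-*ₛ` this makes the quotient unique, so a product formula such as `bin-⟨q⟩` determines
  -- `gaussian`.
  *ₛ-÷ₛ : ∀ a b → b 0 ≡ 1ℤ → (a *ₛ b) ÷ₛ b ≗ a
  *ₛ-÷ₛ a b b₀≡1 zero    = trans (ℤₚ.+-identityʳ _)
    (trans (cong (a 0 ℤ.*_) b₀≡1) (ℤₚ.*-identityʳ (a 0)))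
  *ₛ-÷ₛ a b b₀≡1 (suc n) = trans
    (÷ₛ-congˡ b (λ k → trans
      (cong (λ x → (a *ₛ b) (suc k) ℤ.- x ℤ.* b (suc k)) (*ₛ-÷ₛ a b b₀≡1 0))
      (cancel (a 0 ℤ.* b (suc k)) _)) n)
    (*ₛ-÷ₛ (tail a) b b₀≡1 n)
    where
    cancel : ∀ x y → x ℤ.+ y ℤ.- x ≡ y
    cancel = ℤ-Solver.solve-∀

  -- Polynomials with nonnegative coefficients, as finite sums of powers of q.
  data ℕ[q] : Series → Set where
    zeroᵖ : ℕ[q] 0ₛ
    powᵖ  : ∀ j → ℕ[q] (q^ j)
    _+ᵖ_  : ∀ {a b} → ℕ[q] a → ℕ[q] b → ℕ[q] (a +ₛ b)
    respᵖ : ∀ {a b} → a ≗ b → ℕ[q] a → ℕ[q] b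

  open CommutativeRing seriesRing
    using (zeroʳ; distribˡ; distribʳ) renaming (sym to ≗-sym)

  _*ᵖ_ : ∀ {a b} → ℕ[q] a → ℕ[q] b → ℕ[q] (a *ₛ b)
  _*ᵖ_ {b = b} zeroᵖ                    y = respᵖ (≗-sym (*ₛ-zeroˡ b)) zeroᵖ
  _*ᵖ_ {b = b} (_+ᵖ_ {a₁} {a₂} x₁ x₂)   y =
    respᵖ (≗-sym (distribʳ b a₁ a₂)) ((x₁ *ᵖ y) +ᵖ (x₂ *ᵖ y))
  respᵖ eq x *ᵖ y                         = respᵖ (*ₛ-cong eq (λ _ → refl)) (x *ᵖ y)
  powᵖ j     *ᵖ zeroᵖ                     = respᵖ (≗-sym (zeroʳ (q^ j))) zeroᵖ
  powᵖ j     *ᵖ powᵖ k                    = respᵖ (q^-+ j k) (powᵖ (j + k))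
  powᵖ j     *ᵖ (_+ᵖ_ {b₁} {b₂} y₁ y₂)    =
    respᵖ (≗-sym (distribˡ (q^ j) b₁ b₂)) ((powᵖ j *ᵖ y₁) +ᵖ (powᵖ j *ᵖ y₂))
  powᵖ j     *ᵖ respᵖ eq y                =
    respᵖ (*ₛ-cong {q^ j} (λ _ → refl) eq) (powᵖ j *ᵖ y)

  nonneg : ∀ {a} → ℕ[q] a → ∀ n → 0ℤ ℤ.≤ a n
  nonneg zeroᵖ        n = ℤₚ.≤-refl
  nonneg (powᵖ zero) zero = ℤ.+≤+ z≤n
  nonneg (powᵖ (suc j)) zero = ℤ.+≤+ z≤n
  nonneg (powᵖ zero) (suc n) = ℤ.+≤+ z≤n
  nonneg (powᵖ (suc j)) (suc n) = nonneg (powᵖ j) n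
  nonneg (x +ᵖ y)     n = ℤₚ.+-mono-≤ (nonneg x n) (nonneg y n)
  nonneg (respᵖ eq x) n = subst (0ℤ ℤ.≤_) (eq n) (nonneg x n)

  q^-above : ∀ j n → j < n → (q^ j) n ≡ 0ℤ
  q^-above zero    (suc n) _         = refl
  q^-above (suc j) (suc n) (s<s j<n) = q^-above j n j<n

  bounded : ∀ {a} → ℕ[q] a → ∃[ d ] (∀ n → d < n → a n ≡ 0ℤ)
  bounded zeroᵖ        = 0 , λ _ _ → refl
  bounded (powᵖ j)     = j , q^-above j
  bounded (x +ᵖ y)     with bounded x | bounded y
  ... | d , x≡0 | e , y≡0 = d + e , λ n d+e<n → cong₂ ℤ._+_
    (x≡0 n (ℕₚ.≤-<-trans (ℕₚ.m≤m+n d e) d+e<n))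
    (y≡0 n (ℕₚ.≤-<-trans (ℕₚ.m≤n+m e d) d+e<n))
  bounded (respᵖ eq x) with bounded x
  ... | d , x≡0 = d , λ n d<n → trans (sym (eq n)) (x≡0 n d<n)

  ℕ[q]⇒≥0 : ∀ {a} {P : FormalSum} → ℕ[q] a → (∀ r → P r ≡ embed a r) → P ≥0
  ℕ[q]⇒≥0 {a} x P≗a = a , bounded x , nonneg x , P≗a

-- The q-binomial coefficients of the statement as polynomials

module SeriesBinomial where

  open import Data.Nat.Base using (_+_; _*_; _∸_)

  open SeriesRing public
  module R = CommutativeRing seriesRing
  open QBinomial seriesRing public
  open Gaussian q^_ (λ _ → refl) q^-+ public

  ∑ᵖ : ∀ n {f} → (∀ i → ℕ[q] (f i)) → ℕ[q] (∑ n f)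
  ∑ᵖ zero    {f} p = respᵖ (R.sym (∑-empty f)) zeroᵖ
  ∑ᵖ (suc n) {f} p = respᵖ (R.sym (∑-cons n f)) (p 0 +ᵖ ∑ᵖ n (p ∘ suc))

  binᵖ : ∀ n k → ℕ[q] (bin n k)
  binᵖ n       zero    = powᵖ 0
  binᵖ zero    (suc k) = zeroᵖ
  binᵖ (suc n) (suc k) = binᵖ n k +ᵖ (powᵖ (suc k) *ᵖ binᵖ n (suc k))

  transformᵖ : ∀ e L {h} → (∀ t → ℕ[q] (h t)) → ℕ[q] (transform e L h)
  transformᵖ e L p = ∑ᵖ (suc L) (λ t → ∑ᵖ (suc L) (λ c →
    (powᵖ (c * c + c * (t + t + e) + 2 * t * (t + e)) *ᵖ (binᵖ L c *ᵖ binᵖ (L ∸ c) (t + t + e))) *ᵖ p t))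

  rrᵖ : ∀ e s → ℕ[q] (rr e s)
  rrᵖ e s = ∑ᵖ (suc s) (λ c → powᵖ (c * c + c * e) *ᵖ binᵖ s c)

  ε·≗ : ∀ a → ε *ₛ a ≗ -ₛ a
  ε·≗ = RingProperties.-1*x≈-x R.ring

  ⟨q⟩≗ : ∀ m → ⟨q⟩ m ≗ ⟨q⟩ᴿ m
  ⟨q⟩≗ zero    = λ _ → refl
  ⟨q⟩≗ (suc m) = *ₛ-cong (⟨q⟩≗ m) (λ n →
    cong (λ z → (q^ 0) n ℤ.+ z) (sym (ε·≗ (q^ suc m) n)))

  gaussian≗bin : ∀ m n → gaussian (+ m) (+ n) ≗ bin (m + n) m
  gaussian≗bin m n = R.trans
    (÷ₛ-congˡ d (R.trans (⟨q⟩≗ (m + n)) (R.trans (R.sym (bin-⟨q⟩ m n))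
      (*ₛ-cong {bin (m + n) m} (λ _ → refl) (R.sym (*ₛ-cong (⟨q⟩≗ m) (⟨q⟩≗ n)))))))
    (*ₛ-÷ₛ (bin (m + n) m) d (cong₂ (λ x y → x ℤ.* y ℤ.+ 0ℤ) (⟨q⟩-const m) (⟨q⟩-const n)))
    where
    d = ⟨q⟩ m *ₛ ⟨q⟩ n

  -- The two zero conventions agree: a negative n - k falls into the default clause of `gaussian`,
  -- while `bin n k` vanishes for n < k. So all j can be treated alike.
  gaussian-⊖ˡ : ∀ n k → gaussian (n ⊖ k) (+ k) ≗ bin n k
  gaussian-⊖ˡ n k with ℕₚ.≤-<-connex k n
  ... | inj₁ k≤n rewrite ℤₚ.⊖-≥ k≤n = R.trans (gaussian≗bin (n ∸ k) k)
    (R.trans (bin-sym (n ∸ k) k) (R.reflexive (cong (λ m → bin m k) (ℕₚ.m∸n+n≡m k≤n))))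
  -- Exposing `k ∸ n` as a successor makes its negation visibly negative.
  ... | inj₂ n<k rewrite ℤₚ.⊖-< n<k with k ∸ n | ℕₚ.m<n⇒0<n∸m n<k
  ...   | suc p | _ = R.sym (bin-> n<k)

  gaussian-⊖ʳ : ∀ n k → gaussian (+ k) (n ⊖ k) ≗ bin n k
  gaussian-⊖ʳ n k with ℕₚ.≤-<-connex k n
  ... | inj₁ k≤n rewrite ℤₚ.⊖-≥ k≤n = R.trans (gaussian≗bin k (n ∸ k))
    (R.reflexive (cong (λ m → bin m k) (ℕₚ.m+[n∸m]≡n k≤n)))
  ... | inj₂ n<k rewrite ℤₚ.⊖-< n<k with k ∸ n | ℕₚ.m<n⇒0<n∸m n<k
  ...   | suc p | _ = R.sym (bin-> n<k)

  -- For j ≥ 0 the lower index N - 4j may be negative, so its complement M + 4j is used; for j < 0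
  -- the lower index itself is a natural number.
  qbinom-+ : ∀ N M k →
    qbinom (+ N ℤ.+ + M) (+ N ℤ.- + 4 ℤ.* + k) ≗ bin (N + M) (M + 4 * k)
  qbinom-+ N M k = R.trans (R.reflexive (cong₂ gaussian bottom top)) (gaussian-⊖ˡ (N + M) (M + 4 * k))
    where
    m+4k : + (M + 4 * k) ≡ + M ℤ.+ + 4 ℤ.* + k
    m+4k = trans (ℤₚ.pos-+ M (4 * k)) (cong (λ z → + M ℤ.+ z) (ℤₚ.pos-* 4 k))
    bottom : + N ℤ.- + 4 ℤ.* + k ≡ (N + M) ⊖ (M + 4 * k)
    bottom = begin
      + N ℤ.- + 4 ℤ.* + k                        ≡⟨ cancel (+ N) (+ M) (+ 4 ℤ.* + k) ⟨
      + N ℤ.+ + M ℤ.- (+ M ℤ.+ + 4 ℤ.* + k)      ≡⟨ cong₂ ℤ._-_ (ℤₚ.pos-+ N M) m+4k ⟨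
      + (N + M) ℤ.- + (M + 4 * k)                ≡⟨ ℤₚ.m-n≡m⊖n (N + M) (M + 4 * k) ⟩
      (N + M) ⊖ (M + 4 * k)                      ∎
      where
      open ≡-Reasoning
      cancel : ∀ n m x → n ℤ.+ m ℤ.- (m ℤ.+ x) ≡ n ℤ.- x
      cancel = ℤ-Solver.solve-∀
    top : + N ℤ.+ + M ℤ.- (+ N ℤ.- + 4 ℤ.* + k) ≡ + (M + 4 * k)
    top = trans (cancel (+ N) (+ M) (+ 4 ℤ.* + k)) (sym m+4k)
      where
      cancel : ∀ n m x → n ℤ.+ m ℤ.- (n ℤ.- x) ≡ m ℤ.+ x
      cancel = ℤ-Solver.solve-∀

  qbinom-- : ∀ N M k →
    qbinom (+ N ℤ.+ + M) (+ N ℤ.- + 4 ℤ.* -[1+ k ]) ≗ bin (N + M) (N + 4 * suc k)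
  qbinom-- N M k = R.trans (R.reflexive (cong₂ gaussian bottom top)) (gaussian-⊖ʳ (N + M) (N + 4 * suc k))
    where
    n+4k : + (N + 4 * suc k) ≡ + N ℤ.+ + 4 ℤ.* + suc k
    n+4k = trans (ℤₚ.pos-+ N (4 * suc k)) (cong (λ z → + N ℤ.+ z) (ℤₚ.pos-* 4 (suc k)))
    bottom : + N ℤ.- + 4 ℤ.* (ℤ.- + suc k) ≡ + (N + 4 * suc k)
    bottom = trans (neg (+ N) (+ 4) (+ suc k)) (sym n+4k)
      where
      neg : ∀ n x y → n ℤ.- x ℤ.* (ℤ.- y) ≡ n ℤ.+ x ℤ.* y
      neg = ℤ-Solver.solve-∀
    top : + N ℤ.+ + M ℤ.- (+ N ℤ.- + 4 ℤ.* (ℤ.- + suc k)) ≡ (N + M) ⊖ (N + 4 * suc k)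
    top = begin
      + N ℤ.+ + M ℤ.- (+ N ℤ.- + 4 ℤ.* (ℤ.- + suc k))
        ≡⟨ cong (λ z → + N ℤ.+ + M ℤ.- z) bottom ⟩
      + N ℤ.+ + M ℤ.- + (N + 4 * suc k)
        ≡⟨ cong (λ z → z ℤ.- + (N + 4 * suc k)) (ℤₚ.pos-+ N M) ⟨
      + (N + M) ℤ.- + (N + 4 * suc k)
        ≡⟨ ℤₚ.m-n≡m⊖n (N + M) (N + 4 * suc k) ⟩
      (N + M) ⊖ (N + 4 * suc k) ∎
      where open ≡-Reasoning

  sgn·≗ : ∀ k a n → (sgn k *ₛ a) n ≡ (-1ℤ ℤ.^ k) ℤ.* a n
  sgn·≗ zero    a n = trans (*ₛ-identityˡ a n) (sym (ℤₚ.*-identityˡ (a n)))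
  sgn·≗ (suc k) a n = begin
    ((ε *ₛ sgn k) *ₛ a) n          ≡⟨ *ₛ-assoc ε (sgn k) a n ⟩
    (ε *ₛ (sgn k *ₛ a)) n          ≡⟨ ε·≗ (sgn k *ₛ a) n ⟩
    ℤ.- (sgn k *ₛ a) n             ≡⟨ cong ℤ.-_ (sgn·≗ k a n) ⟩
    ℤ.- ((-1ℤ ℤ.^ k) ℤ.* a n)      ≡⟨ neg (-1ℤ ℤ.^ k) (a n) ⟩
    -1ℤ ℤ.* (-1ℤ ℤ.^ k) ℤ.* a n    ∎
    where
    open ≡-Reasoning
    neg : ∀ x y → ℤ.- (x ℤ.* y) ≡ -1ℤ ℤ.* x ℤ.* y
    neg = ℤ-Solver.solve-∀

-- From rational exponents to power series

module RationalExponents where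

  open import Data.Nat.Base using (_+_; _*_; _∸_; _<_)

  open SeriesBinomial

  -- `fromℤ` passes through normalisation by a gcd, which does not reduce on a variable. In
  -- constructor form `embed` can compute.
  int : ℤ → ℚ
  int i = mkℚ i 0 (Coprimality.sym (Coprimality.1-coprimeTo ∣ i ∣))

  fromℤ≡int : ∀ i → fromℤ i ≡ int i
  fromℤ≡int i = ℚₚ.↥p/↧p≡p (int i)

  int-+ : ∀ i j → int i ℚ.+ int j ≡ int (i ℤ.+ j)
  int-+ i j = trans (cong (ℚ._/ 1) (cong₂ ℤ._+_ (ℤₚ.*-identityʳ i) (ℤₚ.*-identityʳ j)))
    (fromℤ≡int (i ℤ.+ j))

  int-* : ∀ i j → int i ℚ.* int j ≡ int (i ℤ.* j)
  int-* i j = fromℤ≡int (i ℤ.* j)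

  int-neg : ∀ i → ℚ.- int i ≡ int (ℤ.- i)
  int-neg (+ zero)  = refl
  int-neg (+ suc n) = refl
  int-neg -[1+ n ]  = refl

  embed-cong : ∀ {a b} → a ≗ b → ∀ r → embed a r ≡ embed b r
  embed-cong a≗b (mkℚ (+ n) zero _)    = a≗b n
  embed-cong a≗b (mkℚ (+ n) (suc _) _) = refl
  embed-cong a≗b (mkℚ -[1+ n ] _ _)    = refl

  embed-scale : ∀ x a r → x ℤ.* embed a r ≡ embed (λ n → x ℤ.* a n) r
  embed-scale x a (mkℚ (+ n) zero _)    = refl
  embed-scale x a (mkℚ (+ n) (suc _) _) = ℤₚ.*-zeroʳ x
  embed-scale x a (mkℚ -[1+ n ] _ _)    = ℤₚ.*-zeroʳ x

  embed-0 : ∀ r → embed 0ₛ r ≡ 0ℤ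
  embed-0 (mkℚ (+ n) zero _)    = refl
  embed-0 (mkℚ (+ n) (suc _) _) = refl
  embed-0 (mkℚ -[1+ n ] _ _)    = refl

  embed-+ : ∀ a b r → embed (a +ₛ b) r ≡ embed a r ℤ.+ embed b r
  embed-+ a b (mkℚ (+ n) zero _)    = refl
  embed-+ a b (mkℚ (+ n) (suc _) _) = refl
  embed-+ a b (mkℚ -[1+ n ] _ _)    = refl

  embed-∑ : ∀ N f r → sum {N} (λ i → embed (f (toℕ i)) r) ≡ embed (∑ N f) r
  embed-∑ zero    f r = sym (trans (embed-cong (∑-empty f) r) (embed-0 r))
  embed-∑ (suc N) f r = begin
    embed (f 0) r ℤ.+ sum {N} (λ i → embed (f (suc (toℕ i))) r)
      ≡⟨ cong (λ z → embed (f 0) r ℤ.+ z) (embed-∑ N (f ∘ suc) r) ⟩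
    embed (f 0) r ℤ.+ embed (∑ N (f ∘ suc)) r
      ≡⟨ embed-+ (f 0) (∑ N (f ∘ suc)) r ⟨
    embed (f 0 +ₛ ∑ N (f ∘ suc)) r
      ≡⟨ embed-cong (∑-cons N f) r ⟨
    embed (∑ (suc N) f) r ∎
    where open ≡-Reasoning

  embed-int-⊖ : ∀ e a n → embed a (int (n ⊖ e)) ≡ (q^ e *ₛ a) n
  embed-int-⊖ e a n with ℕₚ.≤-<-connex e n
  ... | inj₁ e≤n rewrite ℤₚ.⊖-≥ e≤n = trans (sym (q^-shift e a (n ∸ e)))
    (cong (q^ e *ₛ a) (ℕₚ.m+[n∸m]≡n e≤n))
  ... | inj₂ n<e rewrite ℤₚ.⊖-< n<e with e ∸ n | ℕₚ.m<n⇒0<n∸m n<e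
  ...   | suc p | _ = sym (q^-shift-< e a n n<e)

  embed-not-natural : ∀ a s → (∀ m → s ≢ int (+ m)) → embed a s ≡ 0ℤ
  embed-not-natural a (mkℚ (+ m) zero _)    s≢ = contradiction refl (s≢ m)
  embed-not-natural a (mkℚ (+ m) (suc _) _) s≢ = refl
  embed-not-natural a (mkℚ -[1+ m ] _ _)    s≢ = refl

  not-natural-- : ∀ e r → (∀ m → r ≢ int (+ m)) → ∀ m → r ℚ.- int (+ e) ≢ int (+ m)
  not-natural-- e r r≢ m r-e≡m = r≢ (m + e) (begin
    r                                ≡⟨ cancel r (int (+ e)) ⟩
    r ℚ.- int (+ e) ℚ.+ int (+ e)    ≡⟨ cong (λ z → z ℚ.+ int (+ e)) r-e≡m ⟩
    int (+ m) ℚ.+ int (+ e)          ≡⟨ int-+ (+ m) (+ e) ⟩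
    int (+ m ℤ.+ + e)                ≡⟨ cong int (ℤₚ.pos-+ m e) ⟨
    int (+ (m + e))                  ∎)
    where
    open ≡-Reasoning
    cancel : ∀ x y → x ≡ x ℚ.- y ℚ.+ y
    cancel x y = sym (trans (ℚₚ.+-assoc x (ℚ.- y) y)
      (trans (cong (λ z → x ℚ.+ z) (ℚₚ.+-inverseˡ y)) (ℚₚ.+-identityʳ x)))

  -- Subtracting a natural number cannot make a non-natural `r` natural, so both sides vanish there.
  -- At a natural r < e the left argument is negative, and the product has no coefficient below q^e.
  embed-shift : ∀ e a r → embed a (r ℚ.- int (+ e)) ≡ embed (q^ e *ₛ a) r
  embed-shift e a r@(mkℚ (+ n) zero _) = trans
    (cong (embed a) (trans (cong (λ z → r ℚ.+ z) (int-neg (+ e)))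
      (trans (int-+ (+ n) (ℤ.- + e)) (cong int (ℤₚ.m-n≡m⊖n n e)))))
    (embed-int-⊖ e a n)
  embed-shift e a r@(mkℚ (+ n) (suc d) _) =
    embed-not-natural a (r ℚ.- int (+ e)) (not-natural-- e r (λ m ()))
  embed-shift e a r@(mkℚ -[1+ n ] d _) =
    embed-not-natural a (r ℚ.- int (+ e)) (not-natural-- e r (λ m ()))

  ¼ : ℚ
  ¼ = + 1 ℚ./ 4

  -- All three sums have α + β = 21/4; only c = 4(α - β) varies, being 1, 11 and 9. With K = 4 the
  -- exponent is (21j² + cj)/2, and stating its double avoids halving in ℤ.
  exponent≡ : ∀ α β c → α ℚ.+ β ≡ int (+ 21) ℚ.* ¼ → α ℚ.- β ≡ int c ℚ.* ¼ →
    ∀ j e → + 2 ℤ.* + e ≡ + 21 ℤ.* (j ℤ.* j) ℤ.+ c ℤ.* j →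
    exponent α β 4 j ≡ int (+ e)
  exponent≡ α β c α+β α-β j e 2e = begin
    fromℤ (+ 4 ℤ.* j) ℚ.* (((α ℚ.+ β) ℚ.* fromℤ j ℚ.+ (α ℚ.- β)) ℚ.* ½)
      ≡⟨ cong₂ (λ x y → x ℚ.* (((α ℚ.+ β) ℚ.* y ℚ.+ (α ℚ.- β)) ℚ.* ½))
        (trans (fromℤ≡int (+ 4 ℤ.* j)) (sym (int-* (+ 4) j))) (fromℤ≡int j) ⟩
    int (+ 4) ℚ.* int j ℚ.* (((α ℚ.+ β) ℚ.* int j ℚ.+ (α ℚ.- β)) ℚ.* ½)
      ≡⟨ cong₂ (λ x y → int (+ 4) ℚ.* int j ℚ.* ((x ℚ.* int j ℚ.+ y) ℚ.* ½)) α+β α-β ⟩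
    int (+ 4) ℚ.* int j ℚ.* ((int (+ 21) ℚ.* ¼ ℚ.* int j ℚ.+ int c ℚ.* ¼) ℚ.* ½)
      ≡⟨ solve 3 (λ d x y →
        con (int (+ 4)) :* x :* ((d :* con ¼ :* x :+ y :* con ¼) :* con ½)
        := (d :* (x :* x) :+ y :* x) :* con ½) refl (int (+ 21)) (int j) (int c) ⟩
    (int (+ 21) ℚ.* (int j ℚ.* int j) ℚ.+ int c ℚ.* int j) ℚ.* ½
      ≡⟨ cong (λ x → x ℚ.* ½) (trans (cong₂ ℚ._+_
        (trans (cong (λ z → int (+ 21) ℚ.* z) (int-* j j)) (int-* (+ 21) (j ℤ.* j)))
        (int-* c j)) (int-+ (+ 21 ℤ.* (j ℤ.* j)) (c ℤ.* j))) ⟩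
    int (+ 21 ℤ.* (j ℤ.* j) ℤ.+ c ℤ.* j) ℚ.* ½
      ≡⟨ cong (λ x → int x ℚ.* ½) 2e ⟨
    int (+ 2 ℤ.* + e) ℚ.* ½
      ≡⟨ cong (λ x → x ℚ.* ½) (int-* (+ 2) (+ e)) ⟨
    int (+ 2) ℚ.* int (+ e) ℚ.* ½
      ≡⟨ solve 1 (λ x → con (int (+ 2)) :* x :* con ½ := x) refl (int (+ e)) ⟩
    int (+ e) ∎
    where
    open ≡-Reasoning
    open ℚ-Solver.+-*-Solver

  exponent-+ : ∀ α β c → α ℚ.+ β ≡ int (+ 21) ℚ.* ¼ → α ℚ.- β ≡ int (+ c) ℚ.* ¼ →
    ∀ k e → 2 * e ≡ 21 * (k * k) + c * k → exponent α β 4 (+ k) ≡ int (+ e)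
  exponent-+ α β c α+β α-β k e 2e = exponent≡ α β (+ c) α+β α-β (+ k) e (begin
    + 2 ℤ.* + e                           ≡⟨ ℤₚ.pos-* 2 e ⟨
    + (2 * e)                             ≡⟨ cong +_ 2e ⟩
    + (21 * (k * k) + c * k)              ≡⟨ ℤₚ.pos-+ (21 * (k * k)) (c * k) ⟩
    + (21 * (k * k)) ℤ.+ + (c * k)        ≡⟨ cong₂ ℤ._+_ (trans (ℤₚ.pos-* 21 (k * k))
      (cong (λ z → + 21 ℤ.* z) (ℤₚ.pos-* k k))) (ℤₚ.pos-* c k) ⟩
    + 21 ℤ.* (+ k ℤ.* + k) ℤ.+ + c ℤ.* + k ∎)
    where open ≡-Reasoning

  exponent-- : ∀ α β c → α ℚ.+ β ≡ int (+ 21) ℚ.* ¼ → α ℚ.- β ≡ int (+ c) ℚ.* ¼ →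
    ∀ k e → 2 * e + c * suc k ≡ 21 * (suc k * suc k) → exponent α β 4 -[1+ k ] ≡ int (+ e)
  exponent-- α β c α+β α-β k e 2e = exponent≡ α β (+ c) α+β α-β -[1+ k ] e (begin
    + 2 ℤ.* + e
      ≡⟨ cancel (+ 2 ℤ.* + e) (+ c) (+ suc k) ⟩
    (+ 2 ℤ.* + e ℤ.+ + c ℤ.* + suc k) ℤ.+ + c ℤ.* (ℤ.- + suc k)
      ≡⟨ cong (λ z → z ℤ.+ + c ℤ.* (ℤ.- + suc k)) lifted ⟩
    + 21 ℤ.* (+ suc k ℤ.* + suc k) ℤ.+ + c ℤ.* (ℤ.- + suc k) ∎)
    where
    open ≡-Reasoning
    cancel : ∀ x y z → x ≡ x ℤ.+ y ℤ.* z ℤ.+ y ℤ.* (ℤ.- z)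
    cancel = ℤ-Solver.solve-∀
    lifted : + 2 ℤ.* + e ℤ.+ + c ℤ.* + suc k ≡ + 21 ℤ.* (+ suc k ℤ.* + suc k)
    lifted = begin
      + 2 ℤ.* + e ℤ.+ + c ℤ.* + suc k       ≡⟨ cong₂ ℤ._+_ (ℤₚ.pos-* 2 e) (ℤₚ.pos-* c (suc k)) ⟨
      + (2 * e) ℤ.+ + (c * suc k)           ≡⟨ ℤₚ.pos-+ (2 * e) (c * suc k) ⟨
      + (2 * e + c * suc k)                 ≡⟨ cong +_ 2e ⟩
      + (21 * (suc k * suc k))              ≡⟨ ℤₚ.pos-* 21 (suc k * suc k) ⟩
      + 21 ℤ.* + (suc k * suc k)            ≡⟨ cong (λ z → + 21 ℤ.* z) (ℤₚ.pos-* (suc k) (suc k)) ⟩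
      + 21 ℤ.* (+ suc k ℤ.* + suc k)        ∎

  -- From G to paired alternating sums

  module _ (N M : ℕ) (α β : ℚ) (e⁺ e⁻ : ℕ → ℕ)
    (exponent⁺ : ∀ k → exponent α β 4 (+ k) ≡ int (+ e⁺ k))
    (exponent⁻ : ∀ k → exponent α β 4 -[1+ k ] ≡ int (+ e⁻ k)) where

    private
      W = N + M

    T⁺ T⁻ : ℕ → Series
    T⁺ k = q^ e⁺ k *ₛ bin (N + M) (M + 4 * k)
    T⁻ k = q^ e⁻ k *ₛ bin (N + M) (N + 4 * suc k)

    T : ℤ → Series
    T (+ k)    = sgn k *ₛ T⁺ k
    T -[1+ k ] = sgn k *ₛ (ε *ₛ T⁻ k)

    shifted : ∀ j e {a b} → exponent α β 4 j ≡ int (+ e) → a ≗ b →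
      ∀ r → (q^ exponent α β 4 j · embed a) r ≡ embed (q^ e *ₛ b) r
    shifted j e {a} {b} eq a≗b r = trans
      (cong (λ x → embed a (r ℚ.- x)) eq)
      (trans (embed-cong a≗b (r ℚ.- int (+ e))) (embed-shift e b r))

    summand≡ : ∀ j r → summand (+ N) (+ M) α β 4 j r ≡ embed (T j) r
    summand≡ (+ k) r = begin
      summand (+ N) (+ M) α β 4 (+ k) r
        ≡⟨ cong (λ z → (-1ℤ ℤ.^ k) ℤ.* z) (shifted (+ k) (e⁺ k) (exponent⁺ k) (qbinom-+ N M k) r) ⟩
      (-1ℤ ℤ.^ k) ℤ.* embed (T⁺ k) r
        ≡⟨ embed-scale (-1ℤ ℤ.^ k) (T⁺ k) r ⟩
      embed (λ n → (-1ℤ ℤ.^ k) ℤ.* T⁺ k n) r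
        ≡⟨ embed-cong (sgn·≗ k (T⁺ k)) r ⟨
      embed (T (+ k)) r ∎
      where open ≡-Reasoning
    summand≡ -[1+ k ] r = begin
      summand (+ N) (+ M) α β 4 -[1+ k ] r
        ≡⟨ cong (λ z → (-1ℤ ℤ.^ suc k) ℤ.* z) (shifted -[1+ k ] (e⁻ k) (exponent⁻ k) (qbinom-- N M k) r) ⟩
      (-1ℤ ℤ.^ suc k) ℤ.* embed (T⁻ k) r
        ≡⟨ embed-scale (-1ℤ ℤ.^ suc k) (T⁻ k) r ⟩
      embed (λ n → (-1ℤ ℤ.^ suc k) ℤ.* T⁻ k n) r
        ≡⟨ embed-cong sign r ⟨
      embed (T -[1+ k ]) r ∎
      where
      open ≡-Reasoning
      neg : ∀ x y → x ℤ.* (ℤ.- y) ≡ -1ℤ ℤ.* x ℤ.* y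
      neg = ℤ-Solver.solve-∀
      sign : T -[1+ k ] ≗ λ n → (-1ℤ ℤ.^ suc k) ℤ.* T⁻ k n
      sign n = trans (sgn·≗ k (ε *ₛ T⁻ k) n) (trans
        (cong (λ z → (-1ℤ ℤ.^ k) ℤ.* z) (ε·≗ (T⁻ k) n)) (neg (-1ℤ ℤ.^ k) (T⁻ k n)))

    -- `G` runs over -W ≤ j ≤ W, whereas `θ` takes as many negative as nonnegative indices. The
    -- missing term j = -1 - W is added; its lower index exceeds the top, so it is zero.
    ∑T≗θ : ∑ (suc (W + W)) (λ i → T (i ⊖ W)) ≗
      θ (suc W) (N + M) e⁺ (λ k → M + 4 * k) e⁻ (λ k → N + 4 * suc k)
    ∑T≗θ = begin
      ∑ (suc (W + W)) (λ i → T (i ⊖ W))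
        ≡⟨ cong (λ n → ∑ n (λ i → T (i ⊖ W))) (sym (ℕₚ.+-suc W W)) ⟩
      ∑ (W + suc W) (λ i → T (i ⊖ W))
        ≈⟨ ∑-bilateral W (suc W) T ⟩
      ∑ (suc W) (T ∘ +_) +ₛ ∑ W (T ∘ -[1+_])
        ≈⟨ R.+-congˡ {∑ (suc W) (T ∘ +_)} pad ⟨
      ∑ (suc W) (T ∘ +_) +ₛ ∑ (suc W) (T ∘ -[1+_])
        ≈⟨ ∑-distrib (suc W) (T ∘ +_) (T ∘ -[1+_]) ⟨
      ∑ (suc W) (λ k → T (+ k) +ₛ T -[1+ k ])
        ≈⟨ ∑-cong (suc W) (λ k → R.distribˡ (sgn k) (T⁺ k) (ε *ₛ T⁻ k)) ⟨
      ∑ (suc W) (λ k → sgn k *ₛ (T⁺ k +ₛ ε *ₛ T⁻ k))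
        ≈⟨ θ-def ⟨
      θ (suc W) (N + M) e⁺ (λ k → M + 4 * k) e⁻ (λ k → N + 4 * suc k) ∎
      where
      open import Relation.Binary.Reasoning.Setoid R.setoid
      W< : W < N + 4 * suc W
      W< = ℕₚ.<-≤-trans (ℕₚ.n<1+n W) (ℕₚ.≤-trans (ℕₚ.m≤n*m (suc W) 4) (ℕₚ.m≤n+m _ N))
      last≗0 : T -[1+ W ] ≗ 0ₛ
      last≗0 = R.trans (R.*-congˡ {sgn W} (R.trans (R.*-congˡ {ε} (R.trans
        (R.*-congˡ {q^ e⁻ W} (bin-> W<)) (R.zeroʳ (q^ e⁻ W)))) (R.zeroʳ ε))) (R.zeroʳ (sgn W))
      pad : ∑ (suc W) (T ∘ -[1+_]) ≗ ∑ W (T ∘ -[1+_])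
      pad = R.trans (∑-snoc W (T ∘ -[1+_])) (R.trans
        (R.+-congˡ {∑ W (T ∘ -[1+_])} last≗0) (R.+-identityʳ (∑ W (T ∘ -[1+_]))))

    G≥0 : ∀ {p} → ℕ[q] p →
      θ (suc W) (N + M) e⁺ (λ k → M + 4 * k) e⁻ (λ k → N + 4 * suc k) ≗ p →
      G (+ N) (+ M) α β 4 ≥0
    G≥0 {p} p≥0 θ≗p = ℕ[q]⇒≥0 p≥0 (λ r → begin
      G (+ N) (+ M) α β 4 r
        ≡⟨ sum-cong-≗ {suc (W + W)} (λ i → trans (summand≡ (+ toℕ i ℤ.- + W) r)
          (cong (λ j → embed (T j) r) (ℤₚ.m-n≡m⊖n (toℕ i) W))) ⟩
      sum {suc (W + W)} (λ i → embed (T (toℕ i ⊖ W)) r)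
        ≡⟨ embed-∑ (suc (W + W)) (λ i → T (i ⊖ W)) r ⟩
      embed (∑ (suc (W + W)) (λ i → T (i ⊖ W))) r
        ≡⟨ embed-cong (R.trans ∑T≗θ θ≗p) r ⟩
      embed p r ∎)
      where open ≡-Reasoning

  -- The three families of the statement

  2*tri : ∀ k → 2 * tri k ≡ k * k + k
  2*tri zero    = refl
  2*tri (suc k) = trans (expand k (tri k))
    (trans (cong (λ z → 2 * suc k + z) (2*tri k)) (collect k))
    where
    expand : ∀ k r → 2 * (suc k + r) ≡ 2 * suc k + 2 * r
    expand = solve-∀
    collect : ∀ k → 2 * suc k + (k * k + k) ≡ suc k * suc k + suc k
    collect = solve-∀

  2*[_+tri] : ∀ {y} x k → 2 * x + (k * k + k) ≡ y → 2 * (x + tri k) ≡ y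
  2*[ x +tri] k eq = trans (distrib x (tri k)) (trans (cong (λ z → 2 * x + z) (2*tri k)) eq)
    where
    distrib : ∀ x y → 2 * (x + y) ≡ 2 * x + 2 * y
    distrib = solve-∀

  first-case : ∀ L → G (+ L) (+ L) (+ 11 ℚ./ 4) (+ 5 ℚ./ 2) 4 ≥0
  first-case L = G≥0 L L (+ 11 ℚ./ 4) (+ 5 ℚ./ 2) e⁺ e⁻
    (λ k → exponent-+ (+ 11 ℚ./ 4) (+ 5 ℚ./ 2) 1 refl refl k _ (2*[ 10 * (k * k) +tri] k (expo⁺ k)))
    (λ k → exponent-- (+ 11 ℚ./ 4) (+ 5 ℚ./ 2) 1 refl refl k _ (trans
      (cong (λ z → z + 1 * suc k) (2*[ 10 * (suc k * suc k) +tri] k refl)) (expo⁻ k)))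
    (transformᵖ 0 L (rrᵖ 0)) (first-sum (suc (L + L)) L (s≤s (ℕₚ.m≤m+n L L)))
    where
    e⁺ e⁻ : ℕ → ℕ
    e⁺ k = 10 * (k * k) + tri k
    e⁻ k = 10 * (suc k * suc k) + tri k
    expo⁺ : ∀ k → 2 * (10 * (k * k)) + (k * k + k) ≡ 21 * (k * k) + 1 * k
    expo⁺ = solve-∀
    expo⁻ : ∀ k → 2 * (10 * (suc k * suc k)) + (k * k + k) + 1 * suc k ≡ 21 * (suc k * suc k)
    expo⁻ = solve-∀

  module _ (l : ℕ) where

    private
      -- `l` is L - 1 in the statement, so both arguments of `G` are natural numbers and their sum
      -- is 2L.
      L = suc l
      W = l + (L + 1)
      L<W+1 : L < suc W
      L<W+1 = s≤s (ℕₚ.≤-trans (ℕₚ.m≤m+n L 1) (ℕₚ.m≤n+m (L + 1) l))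
      top : ∀ l → l + (suc l + 1) ≡ suc l + suc l
      top = solve-∀
      index : ∀ l k → l + 4 * suc k ≡ suc l + 3 + 4 * k
      index = solve-∀

      reindex : ∀ a b →
        θ (suc W) W a (λ k → L + 1 + 4 * k) b (λ k → l + 4 * suc k) ≗
        θ (suc W) (L + L) a (λ k → L + 1 + 4 * k) b (λ k → L + 3 + 4 * k)
      reindex a b = θ-cong (suc W) (top l) (λ _ → refl) (λ _ → refl) (λ _ → refl) (index l)

    second-case : G (+ l) (+ (L + 1)) (+ 4 ℚ./ 1) (+ 5 ℚ./ 4) 4 ≥0
    second-case = G≥0 l (L + 1) (+ 4 ℚ./ 1) (+ 5 ℚ./ 4) e⁺ e⁻
      (λ k → exponent-+ (+ 4 ℚ./ 1) (+ 5 ℚ./ 4) 11 refl refl k _ (2*[ 10 * (k * k) + 5 * k +tri] k (expo⁺ k)))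
      (λ k → exponent-- (+ 4 ℚ./ 1) (+ 5 ℚ./ 4) 11 refl refl k _ (trans
        (cong (λ z → z + 11 * suc k) (2*[ 10 * (k * k) + 15 * k + 5 +tri] k refl)) (expo⁻ k)))
      (transformᵖ 1 L (rrᵖ 1)) (R.trans (reindex e⁺ e⁻) (second-sum (suc W) L L<W+1))
      where
      e⁺ e⁻ : ℕ → ℕ
      e⁺ k = 10 * (k * k) + 5 * k + tri k
      e⁻ k = 10 * (k * k) + 15 * k + 5 + tri k
      expo⁺ : ∀ k → 2 * (10 * (k * k) + 5 * k) + (k * k + k) ≡ 21 * (k * k) + 11 * k
      expo⁺ = solve-∀
      expo⁻ : ∀ k → 2 * (10 * (k * k) + 15 * k + 5) + (k * k + k) + 11 * suc k ≡ 21 * (suc k * suc k)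
      expo⁻ = solve-∀

    third-case : G (+ l) (+ (L + 1)) (+ 15 ℚ./ 4) (+ 3 ℚ./ 2) 4 ≥0
    third-case = G≥0 l (L + 1) (+ 15 ℚ./ 4) (+ 3 ℚ./ 2) e⁺ e⁻
      (λ k → exponent-+ (+ 15 ℚ./ 4) (+ 3 ℚ./ 2) 9 refl refl k _ (2*[ 10 * (k * k) + 4 * k +tri] k (expo⁺ k)))
      (λ k → exponent-- (+ 15 ℚ./ 4) (+ 3 ℚ./ 2) 9 refl refl k _ (trans
        (cong (λ z → z + 9 * suc k) (2*[ 10 * (k * k) + 16 * k + 6 +tri] k refl)) (expo⁻ k)))
      (transformᵖ 1 L (rrᵖ 0)) (R.trans (reindex e⁺ e⁻) (third-sum (suc W) L L<W+1))
      where
      e⁺ e⁻ : ℕ → ℕ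
      e⁺ k = 10 * (k * k) + 4 * k + tri k
      e⁻ k = 10 * (k * k) + 16 * k + 6 + tri k
      expo⁺ : ∀ k → 2 * (10 * (k * k) + 4 * k) + (k * k + k) ≡ 21 * (k * k) + 9 * k
      expo⁺ = solve-∀
      expo⁻ : ∀ k → 2 * (10 * (k * k) + 16 * k + 6) + (k * k + k) + 9 * suc k ≡ 21 * (suc k * suc k)
      expo⁻ = solve-∀

open import Data.Integer.Base using (_+_; _-_; _≤_)
open import Data.Rational.Base using (_/_)

mainTheorem13 : ((L : ℕ) → G (+ L) (+ L) (+ 11 / 4) (+ 5 / 2) 4 ≥0)
    × ((L : ℤ) → + 1 ≤ L →
    (G (L - + 1) (L + + 1) (+ 4 / 1) (+ 5 / 4) 4 ≥0)
    × (G (L - + 1) (L + + 1) (+ 15 / 4) (+ 3 / 2) 4 ≥0))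
mainTheorem13 = RationalExponents.first-case , shifted-cases
  where
  shifted-cases : (L : ℤ) → + 1 ≤ L →
    (G (L - + 1) (L + + 1) (+ 4 / 1) (+ 5 / 4) 4 ≥0)
    × (G (L - + 1) (L + + 1) (+ 15 / 4) (+ 3 / 2) 4 ≥0)
  shifted-cases (+ zero)  (ℤ.+≤+ ())
  shifted-cases (+ suc l) _ = RationalExponents.second-case l , RationalExponents.third-case l
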